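{- Connected Vertex Cover parameterized by the size $k$ of a clique cover admits a time efficient PSAKS in which, for every $\alpha>1$, the output graph of the $\alpha$-approximate kernel has $\mathcal{O}\left(k \left\lceil \frac{2\alpha-1}{\alpha-1} \right\rceil\right)$ vertices.
   Context: All graphs are finite, simple and undirected. A connected vertex cover of $G$ is a set $T\subseteq V(G)$ containing an endpoint of every edge such that $G[T]$ is connected. A clique cover of $G$ is a partition of $V(G)$ such that each part induces a clique; its size is the number of parts. The clique cover is given as part of the input. Parameterized minimization problem considered: instances are $((G,\mathcal{C}),k)$ with $G$ a graph, $\mathcal{C}$ a family of subsets of $V(G)$, $k\in\mathbb{N}$; a solution is a set $T\subseteq V(G)$ and its value is (first applicable case) $-\infty$ if $|\mathcal{C}|>k$ or $\mathcal{C}$ is not a clique cover of $G$; $\infty$ if $T$ is not a connected vertex cover of $G$; $|T|$ otherwise. Lossy kernelization: for a parameterized minimization problem $\Pi$, with value $\Pi(I,k,T)$ of a solution $T$ of instance $(I,k)$, let $\mathrm{OPT}(I,k)$ be the minimum value over solutions. For $\alpha\ge 1$, an $\alpha$-approximate kernel is a pair of polynomial-time algorithms: a reduction algorithm mapping $(I,k)$ to an instance $(I',k')$ of $\Pi$ whose size is bounded by a computable function of $k$, and a solution lifting algorithm which, given $(I,k)$, $(I',k')$ and a solution $T'$ of $(I',k')$, computes a solution $T$ of $(I,k)$ with $\frac{\Pi(I,k,T)}{\mathrm{OPT}(I,k)}\le \alpha\cdot\frac{\Pi(I',k',T')}{\mathrm{OPT}(I',k')}$ (i.e. a $c$-approximate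 solution of the reduced instance is turned into an $\alpha c$-approximate solution of the original, for every $c\ge1$). A polynomial-size approximate kernelization scheme (PSAKS) is a family of $\alpha$-approximate kernels, one for each $\alpha>1$, whose output size is at most $f(\alpha)k^{g(\alpha)}$ for some functions $f,g$ independent of $|I|$ and $k$. It is time efficient if both algorithms run in time $f(\alpha)|I|^{c}$ for some computable $f$ and a constant $c$. -}

module Defs where

open import Data.Bool using (Bool; true; false; if_then_else_)
import Data.Bool.Properties as Bool
open import Data.Empty using (⊥)
open import Data.Fin using (Fin)
import Data.Fin.Properties as Fin
open import Data.Fin.Subset using (Subset; _∈_; _∩_; ∣_∣; Nonempty; Empty)
open import Data.Fin.Subset.Properties using (_∈?_; nonempty?)
open import Data.Integer using (+_) renaming (∣_∣ to absℤ)
open import Data.List using (List; []; _∷_; length; foldr; allFin)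
open import Data.List.Membership.Propositional using () renaming (_∈_ to _∈ˡ_)
open import Data.List.Membership.Propositional.Properties using (∈-allFin)
open import Data.List.Relation.Unary.All using (All; all?)
open import Data.List.Relation.Unary.AllPairs using (AllPairs; allPairs?)
open import Data.List.Relation.Unary.Any using (Any; any?; here; there)
open import Data.Nat using (ℕ; zero; suc; _≤_; _<?_; _⊓_; _⊔_) renaming (_+_ to _+ℕ_; _*_ to _*ℕ_; _^_ to _^ℕ_)
open import Data.Product using (∃-syntax; Σ-syntax; _×_; _,_; proj₁; proj₂)
open import Data.Rational as ℚ using (ℚ; 1ℚ; _/_; _+_; _-_; _*_; ↥_; ↧ₙ_)
import Data.Rational.Properties as ℚ
open import Data.Sum using (_⊎_; inj₁; inj₂)
open import Data.Unit using (⊤)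
open import Level using (0ℓ)
import Data.Vec as Vec
open import Data.Vec using ([]; _∷_)
open import Relation.Binary using (Rel; Decidable)
open import Relation.Binary.Construct.Closure.ReflexiveTransitive using (Star; ε; _◅_; _◅◅_)
open import Relation.Binary.PropositionalEquality using (_≡_; _≢_; refl; sym; subst)
open import Relation.Nullary using (Dec; does)
open import Relation.Nullary.Decidable using (_×-dec_; _⊎-dec_; _→-dec_; ¬?; map′)

-- Via R xs u v: some R-walk from u to v has all its inner vertices in xs
-- (Warshall's recursion).
module Warshall {n : ℕ} {R : Rel (Fin n) 0ℓ} (R? : Decidable R) where

  Via : List (Fin n) → Fin n → Fin n → Set
  Via []       u v = u ≡ v ⊎ R u v
  Via (x ∷ xs) u v = Via xs u v ⊎ (Via xs u x × Via xs x v)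

  via? : ∀ xs u v → Dec (Via xs u v)
  via? []       u v = (u Fin.≟ v) ⊎-dec R? u v
  via? (x ∷ xs) u v = via? xs u v ⊎-dec (via? xs u x ×-dec via? xs x v)

  via-base : ∀ xs {u v} → u ≡ v ⊎ R u v → Via xs u v
  via-base []       p = p
  via-base (x ∷ xs) p = inj₁ (via-base xs p)

  via-trans : ∀ {xs u y v} → y ∈ˡ xs → Via xs u y → Via xs y v → Via xs u v
  via-trans {x ∷ xs} (here refl) p q = inj₂ (to p , from q)
    where
    to : ∀ {w} → Via (x ∷ xs) w x → Via xs w x
    to (inj₁ r)       = r
    to (inj₂ (r , _)) = r
    from : ∀ {w} → Via (x ∷ xs) x w → Via xs x w
    from (inj₁ r)       = r
    from (inj₂ (_ , r)) = r
  via-trans (there y∈) (inj₁ p)       (inj₁ q)       = inj₁ (via-trans y∈ p q)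
  via-trans (there y∈) (inj₁ p)       (inj₂ (q , r)) = inj₂ (via-trans y∈ p q , r)
  via-trans (there y∈) (inj₂ (p , q)) (inj₁ r)       = inj₂ (p , via-trans y∈ q r)
  via-trans (there y∈) (inj₂ (p , _)) (inj₂ (_ , r)) = inj₂ (p , r)

  via⇒star : ∀ xs {u v} → Via xs u v → Star R u v
  via⇒star []       (inj₁ refl)    = ε
  via⇒star []       (inj₂ r)       = r ◅ ε
  via⇒star (x ∷ xs) (inj₁ p)       = via⇒star xs p
  via⇒star (x ∷ xs) (inj₂ (p , q)) = via⇒star xs p ◅◅ via⇒star xs q

  star⇒via : ∀ {u v} → Star R u v → Via (allFin n) u v
  star⇒via ε        = via-base (allFin n) (inj₁ refl)
  star⇒via (r ◅ rs) =
    via-trans (∈-allFin _) (via-base (allFin n) (inj₂ r)) (star⇒via rs)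

  star? : Decidable (Star R)
  star? u v = map′ (via⇒star (allFin n)) star⇒via (via? (allFin n) u v)

record Graph : Set where
  field
    order       : ℕ
    edge        : Fin order → Fin order → Bool
    edge-sym    : ∀ u v → edge u v ≡ edge v u
    edge-irrefl : ∀ v → edge v v ≡ false

  Vertex : Set
  Vertex = Fin order

  Adjacent : Rel Vertex 0ℓ
  Adjacent u v = edge u v ≡ true

  adjacent? : Decidable Adjacent
  adjacent? u v = edge u v Bool.≟ true

module _ (G : Graph) where
  open Graph G

  VertexCover : Subset order → Set
  VertexCover T = ∀ u v → Adjacent u v → u ∈ T ⊎ v ∈ T

  InducedAdjacent : Subset order → Rel Vertex 0ℓ
  InducedAdjacent T u v = u ∈ T × v ∈ T × Adjacent u v

  -- The empty set induces a connected graph.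
  InducesConnected : Subset order → Set
  InducesConnected T = ∀ u v → u ∈ T → v ∈ T → Star (InducedAdjacent T) u v

  ConnectedVertexCover : Subset order → Set
  ConnectedVertexCover T = VertexCover T × InducesConnected T

  Clique : Subset order → Set
  Clique P = ∀ u v → u ∈ P → v ∈ P → u ≢ v → Adjacent u v

  -- A list with repeated members does not satisfy this: nonempty sets are not
  -- disjoint from themselves.
  CliqueCover : List (Subset order) → Set
  CliqueCover 𝒞 = All Nonempty 𝒞
                × AllPairs (λ P Q → Empty (P ∩ Q)) 𝒞
                × (∀ v → Any (v ∈_) 𝒞)
                × All Clique 𝒞

  connectedVertexCover? : ∀ T → Dec (ConnectedVertexCover T)
  connectedVertexCover? T =
    Fin.all? (λ u → Fin.all? λ v → adjacent? u v →-dec (u ∈? T ⊎-dec v ∈? T))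
    ×-dec
    Fin.all? (λ u → Fin.all? λ v → u ∈? T →-dec (v ∈? T →-dec star? u v))
    where
    open Warshall (λ u v → u ∈? T ×-dec v ∈? T ×-dec adjacent? u v)

  clique? : ∀ P → Dec (Clique P)
  clique? P = Fin.all? λ u → Fin.all? λ v →
    u ∈? P →-dec (v ∈? P →-dec (¬? (u Fin.≟ v) →-dec adjacent? u v))

  cliqueCover? : ∀ 𝒞 → Dec (CliqueCover 𝒞)
  cliqueCover? 𝒞 =
    all? nonempty? 𝒞
    ×-dec allPairs? (λ P Q → ¬? (nonempty? (P ∩ Q))) 𝒞
    ×-dec Fin.all? (λ v → any? (v ∈?_) 𝒞)
    ×-dec all? clique? 𝒞

record Instance : Set where
  field
    graph  : Graph
    family : List (Subset (Graph.order graph))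

open Instance public

order : Instance → ℕ
order I = Graph.order (graph I)

Solution : Instance → Set
Solution I = Subset (order I)

data Value : Set where
  -∞  : Value
  fin : ℕ → Value
  ∞   : Value

min : Value → Value → Value
min -∞      _       = -∞
min (fin _) -∞      = -∞
min (fin a) (fin b) = fin (a ⊓ b)
min (fin a) ∞       = fin a
min ∞       w       = w

minOver : ∀ n → (Subset n → Value) → Value
minOver zero    φ = φ []
minOver (suc n) φ = min (minOver n (λ T → φ (true ∷ T))) (minOver n (λ T → φ (false ∷ T)))

value : ∀ I → ℕ → Solution I → Value
value I k T =
  if does ((k <? length (family I)) ⊎-dec ¬? (cliqueCover? (graph I) (family I)))
  then -∞
  else if does (¬? (connectedVertexCover? (graph I) T))
  then ∞
  else fin ∣ T ∣

OPT : Instance → ℕ → Value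
OPT I k = minOver (order I) (value I k)

fromℕ : ℕ → ℚ
fromℕ n = + n / 1

-- v ≤[ r ] w  means  v ≤ r · w, for r > 0.
_≤[_]_ : Value → ℚ → Value → Set
-∞    ≤[ r ] _     = ⊤
fin a ≤[ r ] -∞    = ⊥
fin a ≤[ r ] fin b = fromℕ a ℚ.≤ r * fromℕ b
fin a ≤[ r ] ∞     = ⊤
∞     ≤[ r ] -∞    = ⊥
∞     ≤[ r ] fin b = ⊥
∞     ≤[ r ] ∞     = ⊤

Approximate : ℚ → ∀ I k → Solution I → Set
Approximate r I k T = value I k T ≤[ r ] OPT I k

-- Regular Cauchy sequences, as in Bishop and Bridges.
record ℝ : Set where
  field
    approx  : ℕ → ℚ
    regular : ∀ m n → ℚ.∣ approx m - approx n ∣ ℚ.≤ + 1 / suc m + + 1 / suc n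

open ℝ public

-- q ≤ʳ x means q ≤ x, and x ʳ≤ q means x ≤ q.
_≤ʳ_ : ℚ → ℝ → Set
q ≤ʳ x = ∀ n → q ℚ.≤ approx x n + + 1 / suc n

_ʳ≤_ : ℝ → ℚ → Set
x ʳ≤ q = ∀ n → approx x n - + 1 / suc n ℚ.≤ q

record ℝ>1 : Set where
  field
    real    : ℝ
    bound   : ℚ
    1<bound : 1ℚ ℚ.< bound
    bound≤  : bound ≤ʳ real

open ℝ>1 public

-- d = ⌈(2α-1)/(α-1)⌉, that is, d - 1 < (2α-1)/(α-1) ≤ d.  Since
-- (2x-1)/(x-1) = 2 + 1/(x-1) is continuous and decreasing for x > 1, both
-- inequalities can be read off from the rationals q ≥ α.
IsCeiling : ℝ>1 → ℕ → Set
IsCeiling α d =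
    (∀ q → real α ʳ≤ q → fromℕ 2 * q - 1ℚ ℚ.≤ fromℕ d * (q - 1ℚ))
  × (∃[ q ] real α ʳ≤ q × (fromℕ d - 1ℚ) * (q - 1ℚ) ℚ.< fromℕ 2 * q - 1ℚ)

private
  0≤1/ : ∀ n → ℚ.0ℚ ℚ.≤ + 1 / suc n
  0≤1/ n = ℚ.nonNegative⁻¹ (+ 1 / suc n) {{ℚ.normalize-nonNeg 1 (suc n)}}

  ≤+1/ : ∀ q n → q ℚ.≤ q + + 1 / suc n
  ≤+1/ q n = subst (ℚ._≤ q + + 1 / suc n) (ℚ.+-identityʳ q) (ℚ.+-monoʳ-≤ q (0≤1/ n))

fromℚ : ℚ → ℝ
fromℚ q = record
  { approx  = λ _ → q
  ; regular = λ m n → subst (λ z → ℚ.∣ z ∣ ℚ.≤ + 1 / suc m + + 1 / suc n)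
                            (sym (ℚ.+-inverseʳ q))
                            (ℚ.≤-trans (0≤1/ m) (≤+1/ (+ 1 / suc m) n))
  }

fromℚ>1 : ∀ q → 1ℚ ℚ.< q → ℝ>1
fromℚ>1 q 1<q = record
  { real = fromℚ q ; bound = q ; 1<bound = 1<q ; bound≤ = ≤+1/ q }

-- The machine model is Jones' WHILE language over binary trees, written
-- point-free over a single tree-valued store.  Every operation takes unit
-- time, trees being manipulated through shared pointers and inspected only
-- by testing for the leaf; time in this model and Turing machine time are
-- polynomially related.
data Tree : Set where
  nil : Tree
  _∙_ : Tree → Tree → Tree

infixr 5 _∙_

nodes : Tree → ℕ
nodes nil     = 1
nodes (x ∙ y) = suc (nodes x +ℕ nodes y)

data Prog : Set where
  const : Tree → Prog
  skip  : Prog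
  hd tl : Prog
  cons  : Prog → Prog → Prog
  _⨾_   : Prog → Prog → Prog
  cond  : Prog → Prog → Prog → Prog
  while : Prog → Prog → Prog

infixr 4 _⨾_

-- p ∶ x ⟶[ t ] y : on input x, program p halts after t steps with output y.
-- In tests, nil is false and every other tree is true.
infix 3 _∶_⟶[_]_

data _∶_⟶[_]_ : Prog → Tree → ℕ → Tree → Set where
  const  : ∀ {x c} → const c ∶ x ⟶[ 1 ] c
  skip   : ∀ {x} → skip ∶ x ⟶[ 1 ] x
  hd     : ∀ {x y} → hd ∶ x ∙ y ⟶[ 1 ] x
  hd-nil : hd ∶ nil ⟶[ 1 ] nil
  tl     : ∀ {x y} → tl ∶ x ∙ y ⟶[ 1 ] y
  tl-nil : tl ∶ nil ⟶[ 1 ] nil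
  cons   : ∀ {p q x y z s t} →
           p ∶ x ⟶[ s ] y → q ∶ x ⟶[ t ] z →
           cons p q ∶ x ⟶[ suc (s +ℕ t) ] y ∙ z
  _⨾_    : ∀ {p q x y z s t} →
           p ∶ x ⟶[ s ] y → q ∶ y ⟶[ t ] z →
           p ⨾ q ∶ x ⟶[ suc (s +ℕ t) ] z
  cond-true  : ∀ {b p q x y u v s t} →
           b ∶ x ⟶[ s ] u ∙ v → p ∶ x ⟶[ t ] y →
           cond b p q ∶ x ⟶[ suc (s +ℕ t) ] y
  cond-false : ∀ {b p q x y s t} →
           b ∶ x ⟶[ s ] nil → q ∶ x ⟶[ t ] y →
           cond b p q ∶ x ⟶[ suc (s +ℕ t) ] y
  while-true  : ∀ {b p x y z u v r s t} →
           b ∶ x ⟶[ r ] u ∙ v → p ∶ x ⟶[ s ] y → while b p ∶ y ⟶[ t ] z →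
           while b p ∶ x ⟶[ suc (r +ℕ s +ℕ t) ] z
  while-false : ∀ {b p x s} →
           b ∶ x ⟶[ s ] nil →
           while b p ∶ x ⟶[ suc s ] x

codeBool : Bool → Tree
codeBool false = nil
codeBool true  = nil ∙ nil

codeℕ : ℕ → Tree
codeℕ zero    = nil
codeℕ (suc n) = nil ∙ codeℕ n

codeList : ∀ {A : Set} → (A → Tree) → List A → Tree
codeList code = foldr (λ a x → code a ∙ x) nil

codeSubset : ∀ {n} → Subset n → Tree
codeSubset T = codeList codeBool (Vec.toList T)

-- The adjacency matrix, row by row; row u is the neighbourhood of u.
codeGraph : Graph → Tree
codeGraph G = codeList (λ u → codeSubset (Vec.tabulate (edge u))) (allFin _)
  where open Graph G

codeInstance : Instance → Tree
codeInstance I = codeGraph (graph I) ∙ codeList codeSubset (family I)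

codeParameterized : Instance × ℕ → Tree
codeParameterized (I , k) = codeInstance I ∙ codeℕ k

codeℚ>1 : ℚ → Tree
codeℚ>1 q = codeℕ (absℤ (↥ q)) ∙ codeℕ (↧ₙ q)

size : Instance → ℕ
size I = nodes (codeInstance I)

-- Computability refers to finitely represented arguments.
Computable : (ℝ>1 → ℕ) → Set
Computable f = Σ[ p ∈ Prog ] ∀ q (1<q : 1ℚ ℚ.< q) →
  ∃[ t ] p ∶ codeℚ>1 q ⟶[ t ] codeℕ (f (fromℚ>1 q 1<q))

-- An α-approximate kernel, without its bounds on running time and size.
-- As α is real, "(α·c)-approximate" is expressed as "(q·c)-approximate for
-- every rational q ≥ α".
record ApproximateKernel (α : ℝ>1) : Set where
  field
    reduceProg : Prog
    liftProg   : Prog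

    reduce : Instance → ℕ → Instance × ℕ
    lift   : ∀ I k → Solution (proj₁ (reduce I k)) → Solution I

    reduce-runs : ∀ I k → ∃[ t ]
      reduceProg ∶ codeParameterized (I , k) ⟶[ t ] codeParameterized (reduce I k)
    lift-runs : ∀ I k T′ → ∃[ t ]
      liftProg ∶ codeParameterized (I , k) ∙ codeParameterized (reduce I k) ∙ codeSubset T′
        ⟶[ t ] codeSubset (lift I k T′)

    lossy : ∀ I k T′ c → 1ℚ ℚ.≤ c →
      Approximate c (proj₁ (reduce I k)) (proj₂ (reduce I k)) T′ →
      ∀ q → real α ʳ≤ q → Approximate (q * c) I k (lift I k T′)

  output : Instance → ℕ → Instance
  output I k = proj₁ (reduce I k)

  outputSize : Instance → ℕ → ℕ
  outputSize I k = size (output I k) +ℕ proj₂ (reduce I k)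

  -- Both bounds are in terms of |I| alone, for the given instance (I , k).
  RunsWithin : (ℕ → ℕ) → Set
  RunsWithin τ = (∀ I k → proj₁ (reduce-runs I k) ≤ τ (size I))
               × (∀ I k T′ → proj₁ (lift-runs I k T′) ≤ τ (size I))

open ApproximateKernel public

KernelFamily : Set
KernelFamily = (α : ℝ>1) → ApproximateKernel α

-- The code of an instance is never empty, so for k = 0 the bound f(α)·k^g(α)
-- is read with k replaced by 1.
PolynomialSize : KernelFamily → Set
PolynomialSize K = Σ[ f ∈ (ℝ>1 → ℕ) ] Σ[ g ∈ (ℝ>1 → ℕ) ]
  ∀ α I k → outputSize (K α) I k ≤ f α *ℕ (k ⊔ 1) ^ℕ g α

TimeEfficient : KernelFamily → Set
TimeEfficient K = Σ[ f ∈ (ℝ>1 → ℕ) ] Computable f × Σ[ c ∈ ℕ ]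
  ∀ α → RunsWithin (K α) (λ n → f α *ℕ n ^ℕ c)

TimeEfficientPSAKS : KernelFamily → Set
TimeEfficientPSAKS K = PolynomialSize K × TimeEfficient K

{-# OPTIONS --safe #-}
module Submission where

-- A vertex cover misses at most one vertex of each clique, so OPT ≥ n - |𝒞|.
-- Let M satisfy (q - 1)(M - 1) ≥ 1 for every rational q ≥ α.  If n > |𝒞|·M, then
-- n ≤ q(n - |𝒞|) ≤ q·OPT, so the set of all non-isolated vertices, which is a
-- connected vertex cover as soon as there is one at all, is α-approximate and
-- the instance can be replaced by the empty one.  If n ≤ |𝒞|·M, the instance is
-- its own kernel.  It remains to choose M within a constant factor of
-- 2 + 1/(α - 1).  Neither step checks that 𝒞 is a clique cover: if it is not,
-- every solution has value -∞.

open import Defs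
open import Data.Bool using (Bool; true; false; if_then_else_)
open import Data.Bool.ListAction using (or)
open import Data.Bool.Properties using (∨-zeroʳ)
open import Data.Empty using (⊥-elim)
open import Data.Fin using (Fin; zero; suc)
import Data.Fin.Properties as Fin
open import Data.Fin.Subset using (Subset; _∈_; _∉_; ⊤; _∪_; ⁅_⁆; ∣_∣)
open import Data.Fin.Subset.Properties
open import Data.List using (List; []; _∷_; length; map; drop; reverse; _ʳ++_; allFin; tabulate)
open import Data.List.Properties
  using (drop-[]; drop-drop; length-drop; length-map; length-reverse; length-tabulate;
         map-id; map-tabulate; reverse-involutive)
open import Data.List.Relation.Unary.All using (All; []; _∷_)
open import Data.List.Relation.Unary.Any using (Any; here; there)
open import Data.Product using (Σ-syntax; ∃-syntax; _×_; _,_; proj₁; proj₂)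
open import Data.Sum as Sum using (_⊎_; inj₁; inj₂)
open import Data.Unit using (tt)
import Data.Vec as Vec
open Vec using ([]; _∷_)
open import Data.Vec.Properties
  using (lookup⇒[]=; []=⇒lookup; lookup∘tabulate; length-toList)
open import Function using (id; _∘_; case_of_)
open import Relation.Binary.Construct.Closure.ReflexiveTransitive as Star
  using (Star; _◅_; _◅◅_)
open import Relation.Binary.PropositionalEquality
open import Relation.Nullary using (Dec; yes; no; does; ¬_)
open import Relation.Nullary.Decidable using (decidable-stable; _×-dec_; _⊎-dec_; ¬?)

-- The obstacle is that `α` is a Cauchy real: the exact ceiling of 2 + 1/(α - 1) cannot be computed
-- from approximations, which never settle whether a real is an integer. The constant factor in the
-- vertex bound leaves room, so M is read off from a single rational approximation. The rational
-- `bound`, above 1 and at most α, tells in advance how fine that approximation must be. M may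
-- therefore vary with the sequence that represents α. Once chosen, M is a constant built into both
-- programs, so neither of them computes with α. Their running time depends on α only through the
-- size of M, which is at most four times the denominator of `bound`; for rational α that
-- denominator can be read off from the code of α. Instances with |𝒞| > k are also replaced by the
-- empty one: all their solutions have value -∞, and without this test |𝒞| · M would not be bounded
-- in terms of k.

module Rationals where

  open import Data.Integer as ℤ using (+_; +[1+_]; -[1+_])
  import Data.Integer.Properties as ℤₚ
  open import Data.Nat as ℕ using (ℕ; zero; suc)
  import Data.Nat.DivMod as ℕ
  import Data.Nat.Properties as ℕₚ
  open import Data.Rational as ℚ hiding (∣_∣)
  import Data.Rational.Properties as ℚₚ
  open import Data.Rational.Solver using (module +-*-Solver)
  import Data.Rational.Unnormalised as ℚᵘ
  import Data.Rational.Unnormalised.Properties as ℚᵘₚ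

  -- Naturals inside the rationals, and reciprocals.

  toℚᵘ-fromℕ : ∀ n → toℚᵘ (fromℕ n) ℚᵘ.≃ ℚᵘ.mkℚᵘ (+ n) 0
  toℚᵘ-fromℕ n = ℚₚ.toℚᵘ-fromℚᵘ (ℚᵘ.mkℚᵘ (+ n) 0)

  -- `+ n / 1` normalises by a gcd that is stuck for a variable `n`. Arithmetic is therefore done on
  -- unnormalised fractions with denominator 1 and carried back by injectivity of `toℚᵘ`.
  fromℕ-+ : ∀ m n → fromℕ (m ℕ.+ n) ≡ fromℕ m + fromℕ n
  fromℕ-+ m n = ℚₚ.toℚᵘ-injective (begin
    toℚᵘ (fromℕ (m ℕ.+ n))                      ≈⟨ toℚᵘ-fromℕ (m ℕ.+ n) ⟩
    ℚᵘ.mkℚᵘ (+ (m ℕ.+ n)) 0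
      ≈⟨ ℚᵘ.*≡* (cong (ℤ._* + 1) (sym (cong₂ ℤ._+_ (ℤₚ.*-identityʳ (+ m)) (ℤₚ.*-identityʳ (+ n))))) ⟩
    ℚᵘ.mkℚᵘ (+ m) 0 ℚᵘ.+ ℚᵘ.mkℚᵘ (+ n) 0        ≈⟨ ℚᵘₚ.+-cong (toℚᵘ-fromℕ m) (toℚᵘ-fromℕ n) ⟨
    toℚᵘ (fromℕ m) ℚᵘ.+ toℚᵘ (fromℕ n)          ≈⟨ ℚₚ.toℚᵘ-homo-+ (fromℕ m) (fromℕ n) ⟨
    toℚᵘ (fromℕ m + fromℕ n)                    ∎)
    where open ℚᵘₚ.≃-Reasoning

  fromℕ-* : ∀ m n → fromℕ (m ℕ.* n) ≡ fromℕ m * fromℕ n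
  fromℕ-* m n = ℚₚ.toℚᵘ-injective (begin
    toℚᵘ (fromℕ (m ℕ.* n))                      ≈⟨ toℚᵘ-fromℕ (m ℕ.* n) ⟩
    ℚᵘ.mkℚᵘ (+ (m ℕ.* n)) 0                     ≈⟨ ℚᵘ.*≡* (cong (ℤ._* + 1) (ℤₚ.pos-* m n)) ⟩
    ℚᵘ.mkℚᵘ (+ m) 0 ℚᵘ.* ℚᵘ.mkℚᵘ (+ n) 0        ≈⟨ ℚᵘₚ.*-cong (toℚᵘ-fromℕ m) (toℚᵘ-fromℕ n) ⟨
    toℚᵘ (fromℕ m) ℚᵘ.* toℚᵘ (fromℕ n)          ≈⟨ ℚₚ.toℚᵘ-homo-* (fromℕ m) (fromℕ n) ⟨
    toℚᵘ (fromℕ m * fromℕ n)                    ∎)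
    where open ℚᵘₚ.≃-Reasoning

  fromℕ-nonNeg : ∀ n → NonNegative (fromℕ n)
  fromℕ-nonNeg n = ℚₚ.normalize-nonNeg n 1

  fromℕ-pos : ∀ n .{{_ : ℕ.NonZero n}} → Positive (fromℕ n)
  fromℕ-pos n = ℚₚ.normalize-pos n 1

  fromℕ-mono-≤ : ∀ {m n} → m ℕ.≤ n → fromℕ m ≤ fromℕ n
  fromℕ-mono-≤ {m} m≤n with ℕₚ.m≤n⇒∃[o]m+o≡n m≤n
  ... | o , refl = begin
    fromℕ m            ≡⟨ ℚₚ.+-identityʳ (fromℕ m) ⟨
    fromℕ m + 0ℚ       ≤⟨ ℚₚ.+-monoʳ-≤ (fromℕ m) (ℚₚ.nonNegative⁻¹ (fromℕ o) {{fromℕ-nonNeg o}}) ⟩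
    fromℕ m + fromℕ o  ≡⟨ fromℕ-+ m o ⟨
    fromℕ (m ℕ.+ o)    ∎
    where open ℚₚ.≤-Reasoning

  fromℕ-cancel-≤ : ∀ {m n} → fromℕ m ≤ fromℕ n → m ℕ.≤ n
  fromℕ-cancel-≤ {m} {n} m≤n = ℕₚ.≮⇒≥ λ n<m →
    ℚₚ.<-irrefl refl (ℚₚ.<-≤-trans (n<1+n n) (ℚₚ.≤-trans (fromℕ-mono-≤ n<m) m≤n))
    where
    n<1+n : ∀ n → fromℕ n < fromℕ (suc n)
    n<1+n n = begin-strict
      fromℕ n        ≡⟨ ℚₚ.+-identityˡ (fromℕ n) ⟨
      0ℚ + fromℕ n   <⟨ ℚₚ.+-monoˡ-< (fromℕ n) (ℚₚ.positive⁻¹ 1ℚ) ⟩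
      1ℚ + fromℕ n   ≡⟨ fromℕ-+ 1 n ⟨
      fromℕ (suc n)  ∎
      where open ℚₚ.≤-Reasoning

  ↧*p≡↥p : ∀ p → fromℕ (↧ₙ p) * p ≡ ↥ p / 1
  ↧*p≡↥p p = ℚₚ.toℚᵘ-injective (begin
    toℚᵘ (fromℕ (↧ₙ p) * p)                  ≈⟨ ℚₚ.toℚᵘ-homo-* (fromℕ (↧ₙ p)) p ⟩
    toℚᵘ (fromℕ (↧ₙ p)) ℚᵘ.* toℚᵘ p          ≈⟨ ℚᵘₚ.*-congʳ {toℚᵘ p} (toℚᵘ-fromℕ (↧ₙ p)) ⟩
    ℚᵘ.mkℚᵘ (+ ↧ₙ p) 0 ℚᵘ.* toℚᵘ p           ≈⟨ eq p ⟩
    ℚᵘ.mkℚᵘ (↥ p) 0                          ≈⟨ ℚₚ.toℚᵘ-fromℚᵘ (ℚᵘ.mkℚᵘ (↥ p) 0) ⟨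
    toℚᵘ (↥ p / 1)                           ∎)
    where
    open ℚᵘₚ.≃-Reasoning
    eq : ∀ p → ℚᵘ.mkℚᵘ (+ ↧ₙ p) 0 ℚᵘ.* toℚᵘ p ℚᵘ.≃ ℚᵘ.mkℚᵘ (↥ p) 0
    eq (mkℚ n d-1 _) = ℚᵘ.*≡* (trans (ℤₚ.*-identityʳ _) (trans (ℤₚ.*-comm (+ suc d-1) n)
      (cong (λ d → n ℤ.* + suc d) (sym (ℕₚ.+-identityʳ d-1)))))

  n*1/n≡1 : ∀ n .{{_ : ℕ.NonZero n}} → fromℕ n * (+ 1 / n) ≡ 1ℚ
  n*1/n≡1 n@(suc n-1) = ℚₚ.toℚᵘ-injective (begin
    toℚᵘ (fromℕ n * (+ 1 / n))                 ≈⟨ ℚₚ.toℚᵘ-homo-* (fromℕ n) (+ 1 / n) ⟩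
    toℚᵘ (fromℕ n) ℚᵘ.* toℚᵘ (+ 1 / n)
      ≈⟨ ℚᵘₚ.*-cong (toℚᵘ-fromℕ n) (ℚₚ.toℚᵘ-fromℚᵘ (ℚᵘ.mkℚᵘ (+ 1) n-1)) ⟩
    ℚᵘ.mkℚᵘ (+ n) 0 ℚᵘ.* ℚᵘ.mkℚᵘ (+ 1) n-1
      ≈⟨ ℚᵘ.*≡* (trans (ℤₚ.*-identityʳ _) (trans (ℤₚ.*-identityʳ (+ n)) (cong (+_)
           (trans (cong suc (sym (ℕₚ.+-identityʳ n-1))) (sym (ℕₚ.*-identityˡ _)))))) ⟩
    toℚᵘ 1ℚ                                    ∎)
    where open ℚᵘₚ.≃-Reasoning

  -- For `s` = n/d the witness is the integer quotient of d by n. Multiplied by d, the two bounds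
  -- read m · n ≤ d ≤ (m + 1) · n.
  reciprocal-floor : ∀ s → 0ℚ < s → ∃[ m ] fromℕ m * s ≤ 1ℚ × 1ℚ ≤ fromℕ (suc m) * s
  reciprocal-floor (mkℚ (+ 0) _ _) (*<* (ℤ.+<+ ()))
  reciprocal-floor (mkℚ -[1+ _ ] _ _) (*<* ())
  reciprocal-floor s@(mkℚ +[1+ n-1 ] d-1 _) _ =
    m , ℚₚ.*-cancelˡ-≤-pos (fromℕ d) {{fromℕ-pos d}} below
      , ℚₚ.*-cancelˡ-≤-pos (fromℕ d) {{fromℕ-pos d}} above
    where
    open ℚₚ.≤-Reasoning
    open +-*-Solver
    n d m : ℕ
    n = suc n-1
    d = suc d-1
    m = d ℕ./ n
    scaled : ∀ k → fromℕ d * (fromℕ k * s) ≡ fromℕ (k ℕ.* n)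
    scaled k = begin-equality
      fromℕ d * (fromℕ k * s)
        ≡⟨ solve 3 (λ d k s → d :* (k :* s) := k :* (d :* s)) refl (fromℕ d) (fromℕ k) s ⟩
      fromℕ k * (fromℕ d * s)  ≡⟨ cong (fromℕ k *_) (↧*p≡↥p s) ⟩
      fromℕ k * fromℕ n        ≡⟨ fromℕ-* k n ⟨
      fromℕ (k ℕ.* n)          ∎
    below : fromℕ d * (fromℕ m * s) ≤ fromℕ d * 1ℚ
    below = begin
      fromℕ d * (fromℕ m * s)  ≡⟨ scaled m ⟩
      fromℕ (m ℕ.* n)          ≤⟨ fromℕ-mono-≤ (ℕ.m/n*n≤m d n) ⟩
      fromℕ d                  ≡⟨ ℚₚ.*-identityʳ (fromℕ d) ⟨
      fromℕ d * 1ℚ             ∎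
    d≤[1+m]*n : d ℕ.≤ suc m ℕ.* n
    d≤[1+m]*n = subst (ℕ._≤ suc m ℕ.* n) (sym (ℕ.m≡m%n+[m/n]*n d n))
      (ℕₚ.+-monoˡ-≤ (m ℕ.* n) (ℕₚ.<⇒≤ (ℕ.m%n<n d n)))
    above : fromℕ d * 1ℚ ≤ fromℕ d * (fromℕ (suc m) * s)
    above = begin
      fromℕ d * 1ℚ                   ≡⟨ ℚₚ.*-identityʳ (fromℕ d) ⟩
      fromℕ d                        ≤⟨ fromℕ-mono-≤ d≤[1+m]*n ⟩
      fromℕ (suc m ℕ.* n)            ≡⟨ scaled (suc m) ⟨
      fromℕ d * (fromℕ (suc m) * s)  ∎

  p≤∣p∣ : ∀ p → p ≤ ℚ.∣ p ∣
  p≤∣p∣ p with ℚₚ.≤-total 0ℚ p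
  ... | inj₁ 0≤p = ℚₚ.≤-reflexive (sym (ℚₚ.0≤p⇒∣p∣≡p 0≤p))
  ... | inj₂ p≤0 = ℚₚ.≤-trans p≤0 (ℚₚ.0≤∣p∣ p)

  -- A fraction n/d above 1 has n ≥ d + 1, so it exceeds 1 by at least 1/d. Applied to `bound α`,
  -- this makes the denominator a measure of how close to 1 the real `α` may come.
  1≤↧*[p-1] : ∀ p → 1ℚ < p → 1ℚ ≤ fromℕ (↧ₙ p) * (p - 1ℚ)
  1≤↧*[p-1] (mkℚ -[1+ _ ] _ _) (*<* ())
  1≤↧*[p-1] p@(mkℚ (+ n) d-1 _) (*<* 1*d<n*1) = begin
    1ℚ                              ≡⟨ solve 1 (λ d → con 1ℚ := con 1ℚ :+ d :- d) refl (fromℕ d) ⟩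
    1ℚ + fromℕ d - fromℕ d          ≡⟨ cong (_- fromℕ d) (fromℕ-+ 1 d) ⟨
    fromℕ (suc d) - fromℕ d         ≤⟨ ℚₚ.+-monoˡ-≤ (- fromℕ d) (fromℕ-mono-≤ d<n) ⟩
    fromℕ n - fromℕ d               ≡⟨ cong (_- fromℕ d) (↧*p≡↥p p) ⟨
    fromℕ d * p - fromℕ d
      ≡⟨ solve 2 (λ d p → d :* p :- d := d :* (p :- con 1ℚ)) refl (fromℕ d) p ⟩
    fromℕ d * (p - 1ℚ)              ∎
    where
    open ℚₚ.≤-Reasoning
    open +-*-Solver
    d = suc d-1
    d<n : d ℕ.< n
    d<n = ℤₚ.drop‿+<+ (subst₂ ℤ._<_ (ℤₚ.*-identityˡ (+ d)) (ℤₚ.*-identityʳ (+ n)) 1*d<n*1)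

  -- The threshold M for a Cauchy real.

  module Threshold (α : ℝ>1) where
    -- The index makes 4ε = 1/den, which is at most bound α - 1; hence α - 1 and
    -- its lower estimate gap differ by a factor of at most 2.
    den index : ℕ
    den   = ↧ₙ (bound α)
    index = ℕ.pred (4 ℕ.* den)

    ε middle gap : ℚ
    ε      = + 1 / suc index
    middle = approx (real α) index
    gap    = middle - ε - 1ℚ

    private
      open ℚₚ.≤-Reasoning
      open +-*-Solver

      0<ε : 0ℚ < ε
      0<ε = ℚₚ.positive⁻¹ ε {{ℚₚ.normalize-pos 1 (suc index)}}

      den*4ε≡1 : fromℕ den * (fromℕ 4 * ε) ≡ 1ℚ
      den*4ε≡1 = begin-equality
        fromℕ den * (fromℕ 4 * ε)
          ≡⟨ solve 3 (λ d f e → d :* (f :* e) := f :* d :* e) refl (fromℕ den) (fromℕ 4) ε ⟩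
        fromℕ 4 * fromℕ den * ε    ≡⟨ cong (_* ε) (fromℕ-* 4 den) ⟨
        fromℕ (4 ℕ.* den) * ε      ≡⟨ n*1/n≡1 (suc index) ⟩
        1ℚ                         ∎

      4ε≤bound-1 : fromℕ 4 * ε ≤ bound α - 1ℚ
      4ε≤bound-1 = ℚₚ.*-cancelˡ-≤-pos (fromℕ den) {{fromℕ-pos den}} (begin
        fromℕ den * (fromℕ 4 * ε)    ≡⟨ den*4ε≡1 ⟩
        1ℚ                           ≤⟨ 1≤↧*[p-1] (bound α) (1<bound α) ⟩
        fromℕ den * (bound α - 1ℚ)   ∎)

      -- The estimate from above satisfies `middle + ε` ≥ `bound α` ≥ 1 + 4ε, and passing to the
      -- estimate from below costs 2ε.
      2ε≤gap : fromℕ 2 * ε ≤ gap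
      2ε≤gap = begin
        fromℕ 2 * ε
          ≡⟨ solve 1 (λ e → con (fromℕ 2) :* e := con (fromℕ 4) :* e :- con (fromℕ 2) :* e) refl ε ⟩
        fromℕ 4 * ε - fromℕ 2 * ε                  ≤⟨ ℚₚ.+-monoˡ-≤ (- (fromℕ 2 * ε)) 4ε≤bound-1 ⟩
        bound α - 1ℚ - fromℕ 2 * ε
          ≤⟨ ℚₚ.+-monoˡ-≤ (- (fromℕ 2 * ε)) (ℚₚ.+-monoˡ-≤ (- 1ℚ) (bound≤ α index)) ⟩
        middle + ε - 1ℚ - fromℕ 2 * ε
          ≡⟨ solve 2 (λ m e → m :+ e :- con 1ℚ :- con (fromℕ 2) :* e := m :- e :- con 1ℚ) refl middle ε ⟩
        gap                                        ∎

      0<gap : 0ℚ < gap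
      0<gap = ℚₚ.<-≤-trans (ℚₚ.*-monoʳ-<-pos (fromℕ 2) 0<ε) 2ε≤gap

    ⌊1/gap⌋ threshold : ℕ
    ⌊1/gap⌋ = proj₁ (reciprocal-floor gap 0<gap)
    -- One unit turns the floor into an upper bound for 1/gap; the other is the step from M - 1 to
    -- M, which accounts for the one vertex per clique that a cover may miss.
    threshold = suc (suc ⌊1/gap⌋)

    private
      ⌊1/gap⌋*gap≤1 : fromℕ ⌊1/gap⌋ * gap ≤ 1ℚ
      ⌊1/gap⌋*gap≤1 = proj₁ (proj₂ (reciprocal-floor gap 0<gap))

      1≤[1+⌊1/gap⌋]*gap : 1ℚ ≤ fromℕ (suc ⌊1/gap⌋) * gap
      1≤[1+⌊1/gap⌋]*gap = proj₂ (proj₂ (reciprocal-floor gap 0<gap))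

      gap≤ : ∀ q → real α ʳ≤ q → gap ≤ q - 1ℚ
      gap≤ q α≤q = ℚₚ.+-monoˡ-≤ (- 1ℚ) (α≤q index)

      -- Regularity bounds every term by `middle` plus the two error terms. Hence `middle + ε` is
      -- one of the rationals at which `IsCeiling` can be evaluated.
      α≤middle+ε : real α ʳ≤ (middle + ε)
      α≤middle+ε n = begin
        x - δ
          ≡⟨ solve 3 (λ x δ m → x :- δ := (x :- m) :+ (m :- δ)) refl x δ middle ⟩
        (x - middle) + (middle - δ)
          ≤⟨ ℚₚ.+-monoˡ-≤ (middle - δ) (ℚₚ.≤-trans (p≤∣p∣ (x - middle)) (regular (real α) n index)) ⟩
        δ + ε + (middle - δ)
          ≡⟨ solve 3 (λ δ e m → δ :+ e :+ (m :- δ) := m :+ e) refl δ ε middle ⟩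
        middle + ε                     ∎
        where
        x = approx (real α) n
        δ = + 1 / suc n

      ⌊1/gap⌋*2ε≤1 : fromℕ ⌊1/gap⌋ * (fromℕ 2 * ε) ≤ 1ℚ
      ⌊1/gap⌋*2ε≤1 = ℚₚ.≤-trans (ℚₚ.*-monoˡ-≤-nonNeg (fromℕ ⌊1/gap⌋) {{fromℕ-nonNeg ⌊1/gap⌋}} 2ε≤gap)
        ⌊1/gap⌋*gap≤1

    1<≥α : ∀ q → real α ʳ≤ q → 1ℚ < q
    1<≥α q α≤q = begin-strict
      1ℚ             ≡⟨ ℚₚ.+-identityˡ 1ℚ ⟨
      0ℚ + 1ℚ        <⟨ ℚₚ.+-monoˡ-< 1ℚ (ℚₚ.<-≤-trans 0<gap (gap≤ q α≤q)) ⟩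
      q - 1ℚ + 1ℚ    ≡⟨ solve 1 (λ q → q :- con 1ℚ :+ con 1ℚ := q) refl q ⟩
      q              ∎

    threshold-large : ∀ q → real α ʳ≤ q → 1ℚ ≤ fromℕ (suc ⌊1/gap⌋) * (q - 1ℚ)
    threshold-large q α≤q = ℚₚ.≤-trans 1≤[1+⌊1/gap⌋]*gap
      (ℚₚ.*-monoˡ-≤-nonNeg (fromℕ (suc ⌊1/gap⌋)) {{fromℕ-nonNeg (suc ⌊1/gap⌋)}} (gap≤ q α≤q))

    -- ⌊1/gap⌋ is at most 1/(2ε) = 2 · den, and the added 2 is at most 2 · den. This lets running
    -- times be stated through `den`.
    threshold≤4*den : threshold ℕ.≤ 4 ℕ.* den
    threshold≤4*den = ℕₚ.≤-trans
      (ℕₚ.+-mono-≤ (ℕₚ.*-monoʳ-≤ 2 (ℕ.s≤s (ℕ.z≤n {ℚ.denominator-1 (bound α)}))) ⌊1/gap⌋≤2*den)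
      (ℕₚ.≤-reflexive (sym (ℕₚ.*-distribʳ-+ den 2 2)))
      where
      ⌊1/gap⌋≤2*den : ⌊1/gap⌋ ℕ.≤ 2 ℕ.* den
      ⌊1/gap⌋≤2*den = fromℕ-cancel-≤ (begin
        fromℕ ⌊1/gap⌋
          ≡⟨ ℚₚ.*-identityʳ (fromℕ ⌊1/gap⌋) ⟨
        fromℕ ⌊1/gap⌋ * 1ℚ
          ≡⟨ cong (fromℕ ⌊1/gap⌋ *_) den*4ε≡1 ⟨
        fromℕ ⌊1/gap⌋ * (fromℕ den * (fromℕ 4 * ε))
          ≡⟨ solve 3 (λ m d e → m :* (d :* (con (fromℕ 4) :* e)) :=
                             con (fromℕ 2) :* d :* (m :* (con (fromℕ 2) :* e))) refl (fromℕ ⌊1/gap⌋) (fromℕ den) ε ⟩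
        fromℕ 2 * fromℕ den * (fromℕ ⌊1/gap⌋ * (fromℕ 2 * ε))
          ≡⟨ cong (_* (fromℕ ⌊1/gap⌋ * (fromℕ 2 * ε))) (fromℕ-* 2 den) ⟨
        fromℕ (2 ℕ.* den) * (fromℕ ⌊1/gap⌋ * (fromℕ 2 * ε))
          ≤⟨ ℚₚ.*-monoˡ-≤-nonNeg (fromℕ (2 ℕ.* den)) {{fromℕ-nonNeg (2 ℕ.* den)}} ⌊1/gap⌋*2ε≤1 ⟩
        fromℕ (2 ℕ.* den) * 1ℚ                              ≡⟨ ℚₚ.*-identityʳ (fromℕ (2 ℕ.* den)) ⟩
        fromℕ (2 ℕ.* den)                                   ∎)

    -- At the upper estimate q = middle + ε of α one has q - 1 ≤ 2 · gap, so that
    -- threshold - 2 ≤ 1/gap ≤ 2/(q - 1).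
    threshold≤2*ceiling : ∀ d → IsCeiling α d → threshold ℕ.≤ 2 ℕ.* d
    threshold≤2*ceiling d (upper , _) = fromℕ-cancel-≤
      (ℚₚ.*-cancelʳ-≤-pos r {{positive (ℚₚ.<-≤-trans 0<gap (gap≤ q α≤middle+ε))}} (begin
        fromℕ threshold * r                                ≡⟨ cong (_* r) (fromℕ-+ 2 ⌊1/gap⌋) ⟩
        (fromℕ 2 + fromℕ ⌊1/gap⌋) * r
          ≡⟨ solve 3 (λ m x e → (con (fromℕ 2) :+ m) :* (x :+ e :- con 1ℚ) :=
                             m :* (x :- e :- con 1ℚ) :+ m :* (con (fromℕ 2) :* e) :+ con (fromℕ 2) :* (x :+ e :- con 1ℚ))
             refl (fromℕ ⌊1/gap⌋) middle ε ⟩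
        fromℕ ⌊1/gap⌋ * gap + fromℕ ⌊1/gap⌋ * (fromℕ 2 * ε) + fromℕ 2 * r
          ≤⟨ ℚₚ.+-monoˡ-≤ (fromℕ 2 * r) (ℚₚ.+-mono-≤ ⌊1/gap⌋*gap≤1 ⌊1/gap⌋*2ε≤1) ⟩
        1ℚ + 1ℚ + fromℕ 2 * r
          ≡⟨ solve 1 (λ q → con 1ℚ :+ con 1ℚ :+ con (fromℕ 2) :* (q :- con 1ℚ) := con (fromℕ 2) :* q) refl q ⟩
        fromℕ 2 * q                                        ≤⟨ 2q≤2[2q-1] ⟩
        fromℕ 2 * (fromℕ 2 * q - 1ℚ)
          ≤⟨ ℚₚ.*-monoˡ-≤-nonNeg (fromℕ 2) (upper q α≤middle+ε) ⟩
        fromℕ 2 * (fromℕ d * r)                            ≡⟨ ℚₚ.*-assoc (fromℕ 2) (fromℕ d) r ⟨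
        fromℕ 2 * fromℕ d * r                              ≡⟨ cong (_* r) (fromℕ-* 2 d) ⟨
        fromℕ (2 ℕ.* d) * r                                ∎))
      where
      q r : ℚ
      q = middle + ε
      r = q - 1ℚ
      2q≤2[2q-1] : fromℕ 2 * q ≤ fromℕ 2 * (fromℕ 2 * q - 1ℚ)
      2q≤2[2q-1] = ℚₚ.*-monoˡ-≤-nonNeg (fromℕ 2) (begin
        q                       ≡⟨ ℚₚ.+-identityʳ q ⟨
        q + 0ℚ
          ≤⟨ ℚₚ.+-monoʳ-≤ q (ℚₚ.<⇒≤ (ℚₚ.<-≤-trans 0<gap (gap≤ q α≤middle+ε))) ⟩
        q + (q - 1ℚ)
          ≡⟨ solve 1 (λ q → q :+ (q :- con 1ℚ) := con (fromℕ 2) :* q :- con 1ℚ) refl q ⟩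
        fromℕ 2 * q - 1ℚ        ∎)

  -- Inequalities between approximation ratios.

  ≤*-nonNeg : ∀ {c} n → 1ℚ ≤ c → fromℕ n ≤ c * fromℕ n
  ≤*-nonNeg {c} n 1≤c = ℚₚ.≤-trans (ℚₚ.≤-reflexive (sym (ℚₚ.*-identityˡ (fromℕ n))))
    (ℚₚ.*-monoʳ-≤-nonNeg (fromℕ n) {{fromℕ-nonNeg n}} 1≤c)

  ≤[]-weaken : ∀ {v w q c} → 1ℚ ≤ q → 1ℚ ≤ c → v ≤[ c ] w → v ≤[ q * c ] w
  ≤[]-weaken { -∞}    {w}     1≤q 1≤c _   = tt
  ≤[]-weaken {fin a} {fin b} {q} {c} 1≤q 1≤c a≤cb = begin
    fromℕ a               ≤⟨ a≤cb ⟩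
    c * fromℕ b           ≡⟨ ℚₚ.*-identityˡ (c * fromℕ b) ⟨
    1ℚ * (c * fromℕ b)    ≤⟨ ℚₚ.*-monoʳ-≤-nonNeg (c * fromℕ b) {{nonNegative 0≤cb}} 1≤q ⟩
    q * (c * fromℕ b)     ≡⟨ ℚₚ.*-assoc q c (fromℕ b) ⟨
    q * c * fromℕ b       ∎
    where
    open ℚₚ.≤-Reasoning
    0≤cb : 0ℚ ≤ c * fromℕ b
    0≤cb = ℚₚ.≤-trans (ℚₚ.nonNegative⁻¹ (fromℕ a) {{fromℕ-nonNeg a}}) a≤cb
  ≤[]-weaken {fin a} {∞}     1≤q 1≤c _    = tt
  ≤[]-weaken {∞}     {∞}     1≤q 1≤c _    = tt

  -- Here `c` stands for the number of cliques, `t` for the size of a cover and `m` for M - 1. The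
  -- bounds on `n` give c · m ≤ t, so the missed vertices are paid for by c ≤ c · m · (q - 1) ≤ t ·
  -- (q - 1).
  order≤q*cover : ∀ {q} n c t m → 1ℚ ≤ fromℕ m * (q - 1ℚ) →
    c ℕ.* suc m ℕ.≤ n → n ℕ.≤ t ℕ.+ c → fromℕ n ≤ q * fromℕ t
  order≤q*cover {q} n c t m 1≤m[q-1] c[1+m]≤n n≤t+c = begin
    fromℕ n                                          ≤⟨ fromℕ-mono-≤ n≤t+c ⟩
    fromℕ (t ℕ.+ c)                                  ≡⟨ fromℕ-+ t c ⟩
    fromℕ t + fromℕ c
      ≡⟨ cong (_+_ (fromℕ t)) (ℚₚ.*-identityʳ (fromℕ c)) ⟨
    fromℕ t + fromℕ c * 1ℚ
      ≤⟨ ℚₚ.+-monoʳ-≤ (fromℕ t) (ℚₚ.*-monoˡ-≤-nonNeg (fromℕ c) {{fromℕ-nonNeg c}} 1≤m[q-1]) ⟩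
    fromℕ t + fromℕ c * (fromℕ m * (q - 1ℚ))
      ≡⟨ cong (_+_ (fromℕ t)) (ℚₚ.*-assoc (fromℕ c) (fromℕ m) (q - 1ℚ)) ⟨
    fromℕ t + fromℕ c * fromℕ m * (q - 1ℚ)
      ≡⟨ cong (λ x → fromℕ t + x * (q - 1ℚ)) (fromℕ-* c m) ⟨
    fromℕ t + fromℕ (c ℕ.* m) * (q - 1ℚ)
      ≤⟨ ℚₚ.+-monoʳ-≤ (fromℕ t) (ℚₚ.*-monoʳ-≤-nonNeg (q - 1ℚ) {{0≤q-1}} (fromℕ-mono-≤ cm≤t)) ⟩
    fromℕ t + fromℕ t * (q - 1ℚ)
      ≡⟨ solve 2 (λ t q → t :+ t :* (q :- con 1ℚ) := q :* t) refl (fromℕ t) q ⟩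
    q * fromℕ t                                      ∎
    where
    open ℚₚ.≤-Reasoning
    open +-*-Solver
    0≤q-1 : NonNegative (q - 1ℚ)
    0≤q-1 = nonNegative (ℚₚ.≮⇒≥ λ q-1<0 → ℚₚ.<-irrefl refl (begin-strict
      0ℚ                   <⟨ ℚₚ.positive⁻¹ 1ℚ ⟩
      1ℚ                   ≤⟨ 1≤m[q-1] ⟩
      fromℕ m * (q - 1ℚ)   ≤⟨ ℚₚ.*-monoˡ-≤-nonNeg (fromℕ m) {{fromℕ-nonNeg m}} (ℚₚ.<⇒≤ q-1<0) ⟩
      fromℕ m * 0ℚ         ≡⟨ ℚₚ.*-zeroʳ (fromℕ m) ⟩
      0ℚ                   ∎))
    cm≤t : c ℕ.* m ℕ.≤ t
    cm≤t = ℕₚ.+-cancelˡ-≤ c (c ℕ.* m) t (ℕₚ.≤-trans (ℕₚ.≤-reflexive (sym (ℕₚ.*-suc c m)))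
      (ℕₚ.≤-trans c[1+m]≤n (ℕₚ.≤-trans n≤t+c (ℕₚ.≤-reflexive (ℕₚ.+-comm t c)))))

open Rationals

open import Data.Nat
open import Data.Nat.Properties
open import Data.Nat.Tactic.RingSolver using (solve-∀)
open import Data.Rational as ℚ using (ℚ; 1ℚ)
import Data.Rational.Properties as ℚ

-- The optimum is attained.

min-sel : ∀ v w → min v w ≡ v ⊎ min v w ≡ w
min-sel -∞      w       = inj₁ refl
min-sel (fin a) -∞      = inj₂ refl
min-sel (fin a) (fin b) = Sum.map (cong fin) (cong fin) (⊓-sel a b)
min-sel (fin a) ∞       = inj₁ refl
min-sel ∞       w       = inj₂ refl

minOver-attained : ∀ n φ → ∃[ T ] minOver n φ ≡ φ T
minOver-attained zero    φ = [] , refl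
minOver-attained (suc n) φ
  with minOver-attained n (λ T → φ (true ∷ T)) | minOver-attained n (λ T → φ (false ∷ T))
     | min-sel (minOver n (λ T → φ (true ∷ T))) (minOver n (λ T → φ (false ∷ T)))
... | T , eq | _ | inj₁ sel = true ∷ T , trans sel eq
... | _ | T , eq | inj₂ sel = false ∷ T , trans sel eq

∣p∪q∣≤∣p∣+∣q∣ : ∀ {n} (p q : Subset n) → ∣ p ∪ q ∣ ≤ ∣ p ∣ + ∣ q ∣
∣p∪q∣≤∣p∣+∣q∣ []          []          = z≤n
∣p∪q∣≤∣p∣+∣q∣ (true ∷ p)  (true ∷ q)  = s≤s (≤-trans (∣p∪q∣≤∣p∣+∣q∣ p q) (+-monoʳ-≤ ∣ p ∣ (n≤1+n ∣ q ∣)))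
∣p∪q∣≤∣p∣+∣q∣ (true ∷ p)  (false ∷ q) = s≤s (∣p∪q∣≤∣p∣+∣q∣ p q)
∣p∪q∣≤∣p∣+∣q∣ (false ∷ p) (true ∷ q)  = ≤-trans (s≤s (∣p∪q∣≤∣p∣+∣q∣ p q)) (≤-reflexive (sym (+-suc ∣ p ∣ ∣ q ∣)))
∣p∪q∣≤∣p∣+∣q∣ (false ∷ p) (false ∷ q) = ∣p∪q∣≤∣p∣+∣q∣ p q

-- Non-isolated vertices, and the lower bound on vertex covers.

or-tabulate⁺ : ∀ {n} (f : Fin n → Bool) v → f v ≡ true → or (Vec.toList (Vec.tabulate f)) ≡ true
or-tabulate⁺ f zero    fv rewrite fv = refl
or-tabulate⁺ f (suc v) fv rewrite or-tabulate⁺ (λ i → f (suc i)) v fv = ∨-zeroʳ (f zero)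

or-tabulate⁻ : ∀ {n} (f : Fin n → Bool) → or (Vec.toList (Vec.tabulate f)) ≡ true → ∃[ v ] f v ≡ true
or-tabulate⁻ {suc n} f eq with f zero in f0
... | true  = zero , f0
... | false with or-tabulate⁻ (λ i → f (suc i)) eq
...   | v , fv = suc v , fv

module _ (G : Graph) where
  open Graph G using (Vertex; Adjacent; edge; edge-sym) renaming (order to n)

  hasNeighbour : Vertex → Bool
  hasNeighbour v = or (Vec.toList (Vec.tabulate (edge v)))

  nonIsolated : Subset n
  nonIsolated = Vec.tabulate hasNeighbour

  adjacent⇒nonIsolated : ∀ {u v} → Adjacent u v → u ∈ nonIsolated
  adjacent⇒nonIsolated {u} {v} uv =
    lookup⇒[]= u _ (trans (lookup∘tabulate hasNeighbour u) (or-tabulate⁺ (edge u) v uv))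

  nonIsolated⇒adjacent : ∀ {u} → u ∈ nonIsolated → ∃[ v ] Adjacent u v
  nonIsolated⇒adjacent {u} u∈ =
    or-tabulate⁻ (edge u) (trans (sym (lookup∘tabulate hasNeighbour u)) ([]=⇒lookup u∈))

  adjacent-sym : ∀ {u v} → Adjacent u v → Adjacent v u
  adjacent-sym {u} {v} uv = trans (edge-sym v u) uv

  -- A non-isolated vertex lies in `T` or has a neighbour there, as `T` covers its edges. A walk
  -- inside `T` runs along edges, whose ends are never isolated. So two such vertices are joined by
  -- at most one step into `T`, a walk in `T` and at most one step out.
  nonIsolated-cvc : ∀ {T} → ConnectedVertexCover G T → ConnectedVertexCover G nonIsolated
  nonIsolated-cvc {T} (cover , conn) = (λ u v uv → inj₁ (adjacent⇒nonIsolated uv)) , connected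
    where
    toNonIsolated : ∀ {u v} → Adjacent u v → InducedAdjacent G nonIsolated u v
    toNonIsolated uv = adjacent⇒nonIsolated uv , adjacent⇒nonIsolated (adjacent-sym uv) , uv

    toT : ∀ {u} → u ∈ nonIsolated → ∃[ x ] x ∈ T × Star (InducedAdjacent G nonIsolated) u x
                                                × Star (InducedAdjacent G nonIsolated) x u
    toT {u} u∈ with nonIsolated⇒adjacent u∈
    ... | v , uv with cover u v uv
    ...   | inj₁ u∈T = u , u∈T , Star.ε , Star.ε
    ...   | inj₂ v∈T = v , v∈T , toNonIsolated uv ◅ Star.ε , toNonIsolated (adjacent-sym uv) ◅ Star.ε

    connected : InducesConnected G nonIsolated
    connected u v u∈ v∈ with toT u∈ | toT v∈
    ... | x , x∈T , u⇝x , _ | y , y∈T , _ , y⇝v =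
      u⇝x ◅◅ Star.map (λ (_ , _ , e) → toNonIsolated e) (conn x y x∈T y∈T) ◅◅ y⇝v

  -- Each clique misses at most one vertex of a vertex cover; adding that
  -- vertex to the cover removes the clique from consideration.
  order≤cover+cliques : ∀ T 𝒞 → VertexCover G T → All (Clique G) 𝒞 →
    (∀ v → v ∉ T → Any (v ∈_) 𝒞) → n ≤ ∣ T ∣ + length 𝒞
  order≤cover+cliques T [] cover [] covered = begin
    n                    ≡⟨ ∣⊤∣≡n n ⟨
    ∣ ⊤ {n} ∣
      ≤⟨ p⊆q⇒∣p∣≤∣q∣ {p = ⊤ {n}} (λ {v} _ → decidable-stable (v ∈? T) (λ v∉ → case (covered v v∉) of λ ())) ⟩
    ∣ T ∣                ≡⟨ +-identityʳ ∣ T ∣ ⟨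
    ∣ T ∣ + 0          ∎
    where
    open ≤-Reasoning
  order≤cover+cliques T (P ∷ 𝒞) cover (P-clique ∷ cliques) covered
    with Fin.any? (λ x → (x ∈? P) ×-dec ¬? (x ∈? T))
  ... | no P⊆T = ≤-trans
    (order≤cover+cliques T 𝒞 cover cliques covered′)
    (+-monoʳ-≤ ∣ T ∣ (n≤1+n (length 𝒞)))
    where
    covered′ : ∀ v → v ∉ T → Any (v ∈_) 𝒞
    covered′ v v∉T with covered v v∉T
    ... | here v∈P  = ⊥-elim (P⊆T (v , v∈P , v∉T))
    ... | there v∈𝒞 = v∈𝒞
  ... | yes (x , x∈P , x∉T) = begin
    n
      ≤⟨ order≤cover+cliques (T ∪ ⁅ x ⁆) 𝒞 cover′ cliques covered′ ⟩
    ∣ T ∪ ⁅ x ⁆ ∣ + length 𝒞                ≤⟨ +-monoˡ-≤ (length 𝒞) (∣p∪q∣≤∣p∣+∣q∣ T ⁅ x ⁆) ⟩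
    ∣ T ∣ + ∣ ⁅ x ⁆ ∣ + length 𝒞          ≡⟨ cong (λ k → ∣ T ∣ + k + length 𝒞) (∣⁅x⁆∣≡1 x) ⟩
    ∣ T ∣ + 1 + length 𝒞                  ≡⟨ +-assoc ∣ T ∣ 1 (length 𝒞) ⟩
    ∣ T ∣ + suc (length 𝒞)                  ∎
    where
    open ≤-Reasoning
    cover′ : VertexCover G (T ∪ ⁅ x ⁆)
    cover′ u v uv = Sum.map (p⊆p∪q ⁅ x ⁆) (p⊆p∪q ⁅ x ⁆) (cover u v uv)
    covered′ : ∀ v → v ∉ T ∪ ⁅ x ⁆ → Any (v ∈_) 𝒞
    covered′ v v∉ with covered v (λ v∈T → v∉ (p⊆p∪q ⁅ x ⁆ v∈T))
    ... | there v∈𝒞 = v∈𝒞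
    ... | here v∈P with cover x v (P-clique x v x∈P v∈P λ { refl → v∉ (q⊆p∪q T ⁅ x ⁆ (x∈⁅x⁆ x)) })
    ...   | inj₁ x∈T = ⊥-elim (x∉T x∈T)
    ...   | inj₂ v∈T = ⊥-elim (v∉ (p⊆p∪q ⁅ x ⁆ v∈T))

-- Comparison with an optimal solution.

valueBy : ∀ {A B : Set} → Dec A → Dec B → ℕ → Value
valueBy A? B? m = if does A? then -∞ else if does B? then ∞ else fin m

-- `value` unfolds to `valueBy` at its two decisions; with these as variables one can match on them
-- without unfolding the decision procedures. Both sides share `A?`, since the validity of the
-- family does not depend on the solution.
valueBy-≤ : ∀ {A B B′ : Set} (A? : Dec A) (B? : Dec B) (B′? : Dec B′) {m m′ r} →
  (¬ A → ¬ B′ → ¬ B × fromℕ m ℚ.≤ r ℚ.* fromℕ m′) → valueBy A? B? m ≤[ r ] valueBy A? B′? m′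
valueBy-≤ (yes _) _       _        h = tt
valueBy-≤ (no ¬a) (yes b) (yes _)  h = tt
valueBy-≤ (no ¬a) (yes b) (no ¬b′) h = ⊥-elim (proj₁ (h ¬a ¬b′) b)
valueBy-≤ (no ¬a) (no _)  (yes _)  h = tt
valueBy-≤ (no ¬a) (no _)  (no ¬b′) h = proj₂ (h ¬a ¬b′)

-- Only the comparison with a connected vertex cover of a valid instance has content: on an invalid
-- instance `T` has value -∞, and if the optimal `T*` is no connected vertex cover the optimum is ∞.
approximate : ∀ {r} I k (T : Solution I) →
  (∀ T* → length (family I) ≤ k → CliqueCover (graph I) (family I) →
    ConnectedVertexCover (graph I) T* →
    ConnectedVertexCover (graph I) T × fromℕ ∣ T ∣ ℚ.≤ r ℚ.* fromℕ ∣ T* ∣) →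
  Approximate r I k T
approximate {r} I k T h with minOver-attained (order I) (value I k)
... | T* , eq = subst (value I k T ≤[ r ]_) (sym eq)
  (valueBy-≤
    ((k <? length (family I)) ⊎-dec ¬? (cliqueCover? (graph I) (family I)))
    (¬? (connectedVertexCover? (graph I) T)) (¬? (connectedVertexCover? (graph I) T*))
    λ valid cvc* → let cvc , ≤* = h T* (≮⇒≥ (λ k< → valid (inj₁ k<)))
                                     (decidable-stable (cliqueCover? (graph I) (family I)) (λ ¬cc → valid (inj₂ ¬cc)))
                                     (decidable-stable (connectedVertexCover? (graph I) T*) cvc*)
                   in (λ ¬cvc → ¬cvc cvc) , ≤*)

-- Running time bounds, sizes of codes, and list programs.

infix 3 _∶_⟶≤[_]_

_∶_⟶≤[_]_ : Prog → Tree → ℕ → Tree → Set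
p ∶ x ⟶≤[ b ] y = ∃[ t ] t ≤ b × p ∶ x ⟶[ t ] y

0<nodes : ∀ x → 1 ≤ nodes x
0<nodes nil     = ≤-refl
0<nodes (x ∙ y) = s≤s z≤n

nodes-codeList-≥ : ∀ {A : Set} (code : A → Tree) xs → 1 + length xs * 2 ≤ nodes (codeList code xs)
nodes-codeList-≥ code []       = ≤-refl
nodes-codeList-≥ code (x ∷ xs) = s≤s (+-mono-≤ (0<nodes (code x)) (nodes-codeList-≥ code xs))

nodes-codeList-≤ : ∀ {A : Set} (code : A → Tree) {b} → (∀ a → nodes (code a) ≤ b) →
  ∀ xs → nodes (codeList code xs) ≤ 1 + length xs * (1 + b)
nodes-codeList-≤ code bounded []       = ≤-refl
nodes-codeList-≤ code {b} bounded (x ∷ xs) = s≤s (begin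
  nodes (code x) + nodes (codeList code xs)
    ≤⟨ +-mono-≤ (bounded x) (nodes-codeList-≤ code bounded xs) ⟩
  b + (1 + length xs * (1 + b))               ≡⟨ +-suc b _ ⟩
  1 + b + length xs * (1 + b)                 ∎)
  where open ≤-Reasoning

nodes-codeBool : ∀ b → nodes (codeBool b) ≤ 3
nodes-codeBool false = s≤s z≤n
nodes-codeBool true  = ≤-refl

nodes-codeSubset : ∀ {n} (T : Subset n) → nodes (codeSubset T) ≤ 1 + n * 4
nodes-codeSubset T = subst (λ n → nodes (codeSubset T) ≤ 1 + n * 4) (length-toList T)
  (nodes-codeList-≤ codeBool nodes-codeBool (Vec.toList T))

-- The store holds the remaining list and an accumulator. Results are consed onto the accumulator,
-- which reverses them but needs only constant overhead per entry.
mapReverse : Prog → Prog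
mapReverse p = cons skip (const nil) ⨾ while hd (cons (hd ⨾ tl) (cons (hd ⨾ hd ⨾ p) tl)) ⨾ tl

module _ {A B : Set} {code : A → Tree} {code′ : B → Tree} {f : A → B} {p : Prog} {a : ℕ}
  (p-runs : ∀ x → p ∶ code x ⟶≤[ a * nodes (code x) ] code′ (f x)) where

  -- A round takes 12 steps besides those of `p`. They are charged to the cons node of the entry,
  -- and those of `p` to the nodes of the entry itself, so the total is linear in the size of the
  -- code.
  mapReverse-loop : ∀ xs ys →
    while hd (cons (hd ⨾ tl) (cons (hd ⨾ hd ⨾ p) tl)) ∶ codeList code xs ∙ codeList code′ ys
      ⟶≤[ (12 + a) * nodes (codeList code xs) ] nil ∙ codeList code′ (map f xs ʳ++ ys)
  mapReverse-loop []       ys = 2 , s≤s (s≤s z≤n) , while-false hd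
  mapReverse-loop (x ∷ xs) ys with p-runs x | mapReverse-loop xs (f x ∷ ys)
  ... | t , t≤ , run | u , u≤ , loop =
    _ , within , while-true hd (cons (hd ⨾ tl) (cons (hd ⨾ hd ⨾ run) tl)) loop
    where
    open ≤-Reasoning
    m n : ℕ
    m = nodes (code x)
    n = nodes (codeList code xs)
    within : suc (1 + suc (3 + suc (suc (1 + suc (1 + t)) + 1)) + u) ≤ (12 + a) * suc (m + n)
    within = begin
      suc (1 + suc (3 + suc (suc (1 + suc (1 + t)) + 1)) + u)  ≡⟨ time t u ⟩
      12 + t + u                                               ≤⟨ +-mono-≤ (+-monoʳ-≤ 12 t≤) u≤ ⟩
      12 + a * m + (12 + a) * n                                ≤⟨ m≤m+n _ (a + 12 * m) ⟩
      12 + a * m + (12 + a) * n + (a + 12 * m)                 ≡⟨ collect a m n ⟩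
      (12 + a) * suc (m + n)                                   ∎
      where
      time : ∀ t u → suc (1 + suc (3 + suc (suc (1 + suc (1 + t)) + 1)) + u) ≡ 12 + t + u
      time = solve-∀
      collect : ∀ a m n → 12 + a * m + (12 + a) * n + (a + 12 * m) ≡ (12 + a) * suc (m + n)
      collect = solve-∀

  mapReverse-runs : ∀ xs → mapReverse p ∶ codeList code xs
    ⟶≤[ (18 + a) * nodes (codeList code xs) ] codeList code′ (reverse (map f xs))
  mapReverse-runs xs with mapReverse-loop xs []
  ... | t , t≤ , loop = _ , within , cons skip const ⨾ loop ⨾ tl
    where
    open ≤-Reasoning
    n = nodes (codeList code xs)
    within : suc (3 + suc (t + 1)) ≤ (18 + a) * n
    within = begin
      suc (3 + suc (t + 1))      ≡⟨ time t ⟩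
      6 + t                      ≤⟨ +-mono-≤ (*-monoʳ-≤ 6 (0<nodes (codeList code xs))) t≤ ⟩
      6 * n + (12 + a) * n       ≡⟨ *-distribʳ-+ n 6 (12 + a) ⟨
      (18 + a) * n               ∎
      where
      time : ∀ t → suc (3 + suc (t + 1)) ≡ 6 + t
      time = solve-∀

-- The loop skips leading false entries. Its test yields nil both at a true head and at the empty
-- list, so afterwards the store is nonempty exactly if some entry was true.
disjunction : Prog
disjunction = while (cond hd (const nil) skip) tl ⨾ cond skip (const (nil ∙ nil)) (const nil)

disjunction-loop : ∀ bs → ∃[ x ]
    while (cond hd (const nil) skip) tl ∶ codeList codeBool bs ⟶≤[ 5 * nodes (codeList codeBool bs) ] x
  × cond skip (const (nil ∙ nil)) (const nil) ∶ x ⟶[ 3 ] codeBool (or bs)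
disjunction-loop []           =
  _ , (4 , n≤1+n 4 , while-false (cond-false hd-nil skip)) , cond-false skip const
disjunction-loop (true ∷ bs)  =
  _ , (4 , ≤-trans (n≤1+n 4) (*-monoʳ-≤ 5 (0<nodes (codeList codeBool (true ∷ bs))))
         , while-false (cond-true hd const))
    , cond-true skip const
disjunction-loop (false ∷ bs) with disjunction-loop bs
... | x , (t , t≤ , loop) , final =
  x , (5 + t , within , while-true (cond-false hd skip) tl loop) , final
  where
  open ≤-Reasoning
  n = nodes (codeList codeBool bs)
  within : 5 + t ≤ 5 * suc (1 + n)
  within = begin
    5 + t            ≤⟨ +-monoʳ-≤ 5 (≤-trans t≤ (*-monoʳ-≤ 5 (n≤1+n n))) ⟩
    5 + 5 * (1 + n)  ≡⟨ *-suc 5 (1 + n) ⟨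
    5 * suc (1 + n)  ∎

disjunction-runs : ∀ bs → disjunction ∶ codeList codeBool bs ⟶≤[ 9 * nodes (codeList codeBool bs) ] codeBool (or bs)
disjunction-runs bs with disjunction-loop bs
... | x , (t , t≤ , loop) , final = suc (t + 3) , within , loop ⨾ final
  where
  open ≤-Reasoning
  n = nodes (codeList codeBool bs)
  within : suc (t + 3) ≤ 9 * n
  within = begin
    suc (t + 3)    ≡⟨ +-suc t 3 ⟨
    t + 4          ≤⟨ +-mono-≤ t≤ (*-monoʳ-≤ 4 (0<nodes (codeList codeBool bs))) ⟩
    5 * n + 4 * n  ≡⟨ *-distribʳ-+ n 5 4 ⟨
    9 * n          ∎

toList-tabulate : ∀ {A : Set} {n} (f : Fin n → A) → Vec.toList (Vec.tabulate f) ≡ map f (allFin n)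
toList-tabulate {n = n} f = trans (go f) (sym (map-tabulate id f))
  where
  go : ∀ {A : Set} {n} (f : Fin n → A) → Vec.toList (Vec.tabulate f) ≡ tabulate f
  go {n = zero}  f = refl
  go {n = suc n} f = cong (f zero ∷_) (go (f ∘ suc))

nonIsolatedProg : Prog
nonIsolatedProg = mapReverse disjunction ⨾ mapReverse skip

weaken : ∀ {p x y s t} → s ≤ t → p ∶ x ⟶≤[ s ] y → p ∶ x ⟶≤[ t ] y
weaken s≤t (r , r≤s , run) = r , ≤-trans r≤s s≤t , run

⨾-runs : ∀ {p q x y z s t} → p ∶ x ⟶≤[ s ] y → q ∶ y ⟶≤[ t ] z → p ⨾ q ∶ x ⟶≤[ suc (s + t) ] z
⨾-runs (_ , ≤s , run) (_ , ≤t , run′) = _ , s≤s (+-mono-≤ ≤s ≤t) , run ⨾ run′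

exactly : ∀ {p x y t} → p ∶ x ⟶[ t ] y → p ∶ x ⟶≤[ t ] y
exactly run = _ , ≤-refl , run

cond-true-runs : ∀ {b p q x y u v s t} →
  b ∶ x ⟶≤[ s ] u ∙ v → p ∶ x ⟶≤[ t ] y → cond b p q ∶ x ⟶≤[ suc (s + t) ] y
cond-true-runs (_ , ≤s , test) (_ , ≤t , run) = _ , s≤s (+-mono-≤ ≤s ≤t) , cond-true test run

cond-false-runs : ∀ {b p q x y s t} →
  b ∶ x ⟶≤[ s ] nil → q ∶ x ⟶≤[ t ] y → cond b p q ∶ x ⟶≤[ suc (s + t) ] y
cond-false-runs (_ , ≤s , test) (_ , ≤t , run) = _ , s≤s (+-mono-≤ ≤s ≤t) , cond-false test run

-- The first pass asks of each row whether it has a true entry; the second only restores the order.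
-- They cost 27 = 18 + 9 and 19 = 18 + 1 steps per node, and the intermediate list has at most 2N
-- nodes, whence 66 = 1 + 27 + 38.
nonIsolated-runs : ∀ G → nonIsolatedProg ∶ codeGraph G ⟶≤[ 66 * nodes (codeGraph G) ] codeSubset (nonIsolated G)
nonIsolated-runs G = subst (nonIsolatedProg ∶ codeGraph G ⟶≤[ 66 * nodes (codeGraph G) ]_)
  (cong (codeList codeBool) unreverse) (weaken within (⨾-runs first second))
  where
  open ≤-Reasoning
  n N : ℕ
  n = Graph.order G
  N = nodes (codeGraph G)
  bs : List Bool
  bs = map (hasNeighbour G) (allFin n)

  first : mapReverse disjunction ∶ codeGraph G ⟶≤[ 27 * N ] codeList codeBool (reverse bs)
  first = mapReverse-runs {code = λ u → codeSubset (Vec.tabulate (Graph.edge G u))} {code′ = codeBool}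
    {f = hasNeighbour G} {a = 9}
    (λ u → disjunction-runs (Vec.toList (Vec.tabulate (Graph.edge G u)))) (allFin n)

  second : mapReverse skip ∶ codeList codeBool (reverse bs)
    ⟶≤[ 19 * nodes (codeList codeBool (reverse bs)) ] codeList codeBool (reverse (map id (reverse bs)))
  second = mapReverse-runs {code = codeBool} {code′ = codeBool} {f = id} {a = 1}
    (λ b → 1 , subst (1 ≤_) (sym (*-identityˡ (nodes (codeBool b)))) (0<nodes (codeBool b)) , skip) (reverse bs)

  unreverse : reverse (map id (reverse bs)) ≡ Vec.toList (nonIsolated G)
  unreverse = trans (cong reverse (map-id (reverse bs)))
             (trans (reverse-involutive bs) (sym (toList-tabulate (hasNeighbour G))))

  reversed≤ : nodes (codeList codeBool (reverse bs)) ≤ 2 * N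
  reversed≤ = begin
    nodes (codeList codeBool (reverse bs))
      ≤⟨ nodes-codeList-≤ codeBool nodes-codeBool (reverse bs) ⟩
    1 + length (reverse bs) * 4
      ≡⟨ cong (λ l → 1 + l * 4) (trans (length-reverse bs) (length-map (hasNeighbour G) (allFin n))) ⟩
    1 + length (allFin n) * 4                  ≤⟨ n≤1+n _ ⟩
    2 + length (allFin n) * 4                  ≡⟨ double (length (allFin n)) ⟩
    2 * (1 + length (allFin n) * 2)            ≤⟨ *-monoʳ-≤ 2 (nodes-codeList-≥ _ (allFin n)) ⟩
    2 * N                                      ∎
    where
    double : ∀ l → 2 + l * 4 ≡ 2 * (1 + l * 2)
    double = solve-∀

  within : suc (27 * N + 19 * nodes (codeList codeBool (reverse bs))) ≤ 66 * N
  within = begin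
    1 + (27 * N + 19 * nodes (codeList codeBool (reverse bs)))
      ≤⟨ +-mono-≤ (0<nodes (codeGraph G)) (+-monoʳ-≤ (27 * N) (*-monoʳ-≤ 19 reversed≤)) ⟩
    N + (27 * N + 19 * (2 * N))    ≡⟨ total N ⟩
    66 * N                         ∎
    where
    total : ∀ N → N + (27 * N + 19 * (2 * N)) ≡ 66 * N
    total = solve-∀

-- Deciding whether an instance is kept.

stripProg : ℕ → Prog
stripProg zero    = skip
stripProg (suc M) = tl ⨾ stripProg M

-- As `tl` fixes nil, running past the end of the list is harmless, and the time does not depend on
-- its length.
strip-runs : ∀ {A : Set} {code : A → Tree} M xs →
  stripProg M ∶ codeList code xs ⟶[ suc (M * 2) ] codeList code (drop M xs)
strip-runs zero    xs       = skip
strip-runs {code = code} (suc M) [] =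
  tl-nil ⨾ subst (λ ys → stripProg M ∶ nil ⟶[ suc (M * 2) ] codeList code ys) (drop-[] M)
    (strip-runs {code = code} M [])
strip-runs {code = code} (suc M) (x ∷ xs) = tl ⨾ strip-runs {code = code} M xs

pred-runs : ∀ k → tl ∶ codeℕ k ⟶[ 1 ] codeℕ (pred k)
pred-runs zero    = tl-nil
pred-runs (suc k) = tl

-- Compares |𝒞| with k and the order with |𝒞| · M at once, by removing for each
-- member of 𝒞 one unit from k + 1 and M rows from the adjacency matrix.
removeProg : ℕ → Prog
removeProg M = while hd (cons (hd ⨾ tl) (cons (tl ⨾ hd ⨾ tl) (tl ⨾ tl ⨾ stripProg M)))

-- The store becomes family, counter and rows. Starting from k + 1, truncated subtraction of |𝒞|
-- leaves a nonzero counter exactly if |𝒞| ≤ k, so the counter can serve as truth value. A leftover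
-- row means more than |𝒞| · M vertices.
fitsProg : ℕ → Prog
fitsProg M = cons (hd ⨾ tl) (cons (cons (const nil) tl) (hd ⨾ hd))
           ⨾ removeProg M
           ⨾ cond (tl ⨾ tl) (const nil) (tl ⨾ hd)

pred[m]∸n≡m∸suc[n] : ∀ m n → pred m ∸ n ≡ m ∸ suc n
pred[m]∸n≡m∸suc[n] zero    n = 0∸n≡0 n
pred[m]∸n≡m∸suc[n] (suc m) n = refl

remove-runs : ∀ {A B : Set} {code : A → Tree} {code′ : B → Tree} M xs k ys →
  removeProg M ∶ codeList code′ xs ∙ codeℕ k ∙ codeList code ys
    ⟶[ length xs * (17 + M * 2) + 2 ]
  nil ∙ codeℕ (k ∸ length xs) ∙ codeList code (drop (length xs * M) ys)
remove-runs M []       k ys = while-false hd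
remove-runs {code = code} {code′} M (x ∷ xs) k ys
  rewrite sym (drop-drop M (length xs * M) ys)
        | +-assoc (17 + M * 2) (length xs * (17 + M * 2)) 2
        | sym (pred[m]∸n≡m∸suc[n] k (length xs)) =
  while-true hd (cons (hd ⨾ tl) (cons (tl ⨾ hd ⨾ pred-runs k) (tl ⨾ tl ⨾ strip-runs {code = code} M ys)))
    (remove-runs {code = code} {code′ = code′} M xs (pred k) (drop M ys))
module _ (M : ℕ) (I : Instance) (k : ℕ) where
  private
    l = length (family I)

  Fits : Set
  Fits = l ≤ k × order I ≤ l * M

  fits? : Dec Fits
  fits? = l ≤? k ×-dec order I ≤? l * M

  fitsTime : ℕ
  fitsTime = 22 + l * (17 + M * 2)

  private
    open ≤-Reasoning
    time≤ : ∀ r s → s ≤ 7 → suc (11 + suc (r + 2 + s)) ≤ 22 + r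
    time≤ r s s≤7 = begin
      suc (11 + suc (r + 2 + s))  ≡⟨ eq r s ⟩
      15 + r + s                  ≤⟨ +-monoʳ-≤ (15 + r) s≤7 ⟩
      15 + r + 7                  ≡⟨ eq′ r ⟩
      22 + r                      ∎
      where
      eq : ∀ r s → suc (11 + suc (r + 2 + s)) ≡ 15 + r + s
      eq = solve-∀
      eq′ : ∀ r → 15 + r + 7 ≡ 22 + r
      eq′ = solve-∀

    length-rest : length (drop (l * M) (allFin (order I))) ≡ order I ∸ l * M
    length-rest = trans (length-drop (l * M) (allFin (order I))) (cong (_∸ l * M) (length-tabulate id))

  fits-true : Fits → ∃[ x ] fitsProg M ∶ codeParameterized (I , k) ⟶≤[ fitsTime ] nil ∙ x
  fits-true (l≤k , n≤lM)
    -- The program sees only whether rows are left. The rows, their number and the run are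
    -- abstracted together, so that matching on the rows determines the final test.
    with drop (l * M) (allFin (order I)) | length-rest
       | remove-runs {code = λ u → codeSubset (Vec.tabulate (Graph.edge (graph I) u))} {code′ = codeSubset}
           M (family I) (suc k) (allFin (order I))
  ... | _ ∷ _ | len | loop = ⊥-elim (1+n≢0 (trans len (m≤n⇒m∸n≡0 n≤lM)))
  -- The rewrite exposes a successor in the final counter, whose code is then a pair and counts as
  -- true.
  ... | []    | _   | loop rewrite +-∸-assoc 1 l≤k =
    _ , _ , time≤ _ 7 ≤-refl
      , cons (hd ⨾ tl) (cons (cons const tl) (hd ⨾ hd)) ⨾ loop ⨾ cond-false (tl ⨾ tl) (tl ⨾ hd)

  fits-false : ¬ Fits → fitsProg M ∶ codeParameterized (I , k) ⟶≤[ fitsTime ] nil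
  fits-false ¬fits
    with drop (l * M) (allFin (order I)) | length-rest
       | remove-runs {code = λ u → codeSubset (Vec.tabulate (Graph.edge (graph I) u))} {code′ = codeSubset}
           M (family I) (suc k) (allFin (order I))
  ... | _ ∷ _ | len | loop =
    _ , time≤ _ 5 (m≤n+m 5 2)
      , cons (hd ⨾ tl) (cons (cons const tl) (hd ⨾ hd)) ⨾ loop ⨾ cond-true (tl ⨾ tl) const
  ... | []    | len | loop rewrite m≤n⇒m∸n≡0 {suc k} {l} (≰⇒> λ l≤k → ¬fits (l≤k , m∸n≡0⇒m≤n (sym len))) =
    _ , time≤ _ 7 ≤-refl
      , cons (hd ⨾ tl) (cons (cons const tl) (hd ⨾ hd)) ⨾ loop ⨾ cond-false (tl ⨾ tl) (tl ⨾ hd)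

-- The reduction and lifting algorithms.

emptyInstance : Instance
emptyInstance = record
  { graph  = record { order = 0 ; edge = λ () ; edge-sym = λ () ; edge-irrefl = λ () }
  ; family = []
  }

module _ {P : Set} where
  -- The decision is an argument, so that proofs can match on it while it occurs in the type of the
  -- reduced solution.
  reduceBy : Dec P → Instance → ℕ → Instance × ℕ
  reduceBy (yes _) I k = I , k
  reduceBy (no _)  I k = emptyInstance , 0

  liftBy : (P? : Dec P) → ∀ I k → Solution (proj₁ (reduceBy P? I k)) → Solution I
  liftBy (yes _) I k T = T
  liftBy (no _)  I k T = nonIsolated (graph I)

reduceProgram : ℕ → Prog
reduceProgram M = cond (fitsProg M) skip (const (codeParameterized (emptyInstance , 0)))

-- Repeating the test on the original instance reveals which branch the reduction took.
liftProgram : ℕ → Prog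
liftProgram M = cond (hd ⨾ fitsProg M) (tl ⨾ tl) (hd ⨾ hd ⨾ hd ⨾ nonIsolatedProg)

module _ (M : ℕ) (I : Instance) (k : ℕ) where

  reduceProgram-runs : (F? : Dec (Fits M I k)) → reduceProgram M ∶ codeParameterized (I , k)
    ⟶≤[ 2 + fitsTime M I k ] codeParameterized (reduceBy F? I k)
  reduceProgram-runs (yes fits) = weaken (s≤s (≤-reflexive (+-comm (fitsTime M I k) 1)))
    (cond-true-runs (proj₂ (fits-true M I k fits)) (exactly skip))
  reduceProgram-runs (no ¬fits) = weaken (s≤s (≤-reflexive (+-comm (fitsTime M I k) 1)))
    (cond-false-runs (fits-false M I k ¬fits) (exactly const))

  liftProgram-runs : (F? : Dec (Fits M I k)) → ∀ T → liftProgram M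
    ∶ codeParameterized (I , k) ∙ codeParameterized (reduceBy F? I k) ∙ codeSubset T
    ⟶≤[ 9 + fitsTime M I k + 66 * nodes (codeGraph (graph I)) ] codeSubset (liftBy F? I k T)
  liftProgram-runs (yes fits) T = weaken (time≤ (fitsTime M I k) (66 * nodes (codeGraph (graph I))))
    (cond-true-runs (⨾-runs (exactly hd) (proj₂ (fits-true M I k fits))) (exactly (tl ⨾ tl)))
    where
    time≤ : ∀ s t → suc (suc (1 + s) + 3) ≤ 9 + s + t
    time≤ s t = ≤-trans (m≤m+n _ (3 + t)) (≤-reflexive (eq s t))
      where
      eq : ∀ s t → suc (suc (1 + s) + 3) + (3 + t) ≡ 9 + s + t
      eq = solve-∀
  liftProgram-runs (no ¬fits) T = weaken (≤-reflexive (eq (fitsTime M I k) (66 * nodes (codeGraph (graph I)))))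
    (cond-false-runs (⨾-runs (exactly hd) (fits-false M I k ¬fits))
      (⨾-runs (exactly hd) (⨾-runs (exactly hd) (⨾-runs (exactly hd) (nonIsolated-runs (graph I))))))
    where
    eq : ∀ s t → suc (suc (1 + s) + suc (1 + suc (1 + suc (1 + t)))) ≡ 9 + s + t
    eq = solve-∀

-- Bounds on running time, size and order.

length-family≤size : ∀ I → length (family I) ≤ size I
length-family≤size I = begin
  length (family I)                          ≤⟨ m≤m*n _ 2 ⟩
  length (family I) * 2                      ≤⟨ n≤1+n _ ⟩
  1 + length (family I) * 2                  ≤⟨ nodes-codeList-≥ codeSubset (family I) ⟩
  nodes (codeList codeSubset (family I))     ≤⟨ m≤n+m _ _ ⟩
  size I                                     ∎
  where open ≤-Reasoning

-- The constant factor is absorbed into a power of s, which is at least 3.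
runningTime : ∀ {M D s l g} → 1 ≤ D → M ≤ 4 * D → 3 ≤ s → l ≤ s → g ≤ s →
  9 + (22 + l * (17 + M * 2)) + 66 * g ≤ D * s ^ 6
runningTime {M} {D} {s} {l} {g} 1≤D M≤4D 3≤s l≤s g≤s = begin
  9 + (22 + l * (17 + M * 2)) + 66 * g
    ≤⟨ +-mono-≤ (+-monoʳ-≤ 31 (*-mono-≤ l≤s 17+2M≤25D)) (*-monoʳ-≤ 66 g≤s) ⟩
  31 + s * (25 * D) + 66 * s
    ≤⟨ +-mono-≤ (+-monoˡ-≤ (s * (25 * D)) (*-monoʳ-≤ 31 1≤Ds)) (*-monoʳ-≤ 66 (m≤n*m s D {{>-nonZero 1≤D}})) ⟩
  31 * (D * s) + s * (25 * D) + 66 * (D * s)  ≡⟨ collect D s ⟩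
  122 * (D * s)
    ≤⟨ *-monoˡ-≤ (D * s) (≤-trans (m≤m+n 122 121) (^-monoˡ-≤ 5 3≤s)) ⟩
  s ^ 5 * (D * s)                             ≡⟨ reorder (s ^ 5) D s ⟩
  D * s ^ 6                                   ∎
  where
  open ≤-Reasoning
  1≤Ds : 1 ≤ D * s
  1≤Ds = *-mono-≤ 1≤D (≤-trans (s≤s z≤n) 3≤s)
  17+2M≤25D : 17 + M * 2 ≤ 25 * D
  17+2M≤25D = begin
    17 + M * 2            ≤⟨ +-mono-≤ (*-monoʳ-≤ 17 1≤D) (*-monoˡ-≤ 2 M≤4D) ⟩
    17 * D + 4 * D * 2    ≡⟨ eq D ⟩
    25 * D                ∎
    where
    eq : ∀ D → 17 * D + 4 * D * 2 ≡ 25 * D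
    eq = solve-∀
  collect : ∀ D s → 31 * (D * s) + s * (25 * D) + 66 * (D * s) ≡ 122 * (D * s)
  collect = solve-∀
  reorder : ∀ x D s → x * (D * s) ≡ D * (s * x)
  reorder = solve-∀

runningTime-instance : ∀ M D I k → 1 ≤ D → M ≤ 4 * D →
  9 + fitsTime M I k + 66 * nodes (codeGraph (graph I)) ≤ D * size I ^ 6
runningTime-instance M D I k 1≤D M≤4D = runningTime 1≤D M≤4D
  (s≤s (+-mono-≤ (0<nodes (codeGraph (graph I))) (0<nodes (codeList codeSubset (family I)))))
  (length-family≤size I)
  (≤-trans (m≤m+n (nodes (codeGraph (graph I))) (nodes (codeList codeSubset (family I)))) (n≤1+n _))

-- Rows of the matrix and members of the family are both lists of n Booleans. There are at most 2P
-- of them, each with at most 6P nodes including its cons node.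
size-bound : ∀ I {P} → 1 ≤ P → order I ≤ P → length (family I) ≤ P → size I ≤ 15 * (P * P)
size-bound I {P} 1≤P n≤P l≤P = begin
  size I
    ≤⟨ s≤s (+-mono-≤ nodes-graph (nodes-codeList-≤ codeSubset nodes-codeSubset (family I))) ⟩
  suc (1 + n * (2 + n * 4) + (1 + l * (2 + n * 4)))
      ≤⟨ s≤s (+-mono-≤ (+-monoʳ-≤ 1 (*-mono-≤ n≤P row≤)) (+-monoʳ-≤ 1 (*-mono-≤ l≤P row≤))) ⟩
  suc (1 + P * (6 * P) + (1 + P * (6 * P)))  ≡⟨ eq P ⟩
  3 + 12 * (P * P)
    ≤⟨ +-monoˡ-≤ (12 * (P * P)) (*-monoʳ-≤ 3 (*-mono-≤ 1≤P 1≤P)) ⟩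
  3 * (P * P) + 12 * (P * P)                ≡⟨ *-distribʳ-+ (P * P) 3 12 ⟨
  15 * (P * P)                              ∎
  where
  open ≤-Reasoning
  n l : ℕ
  n = order I
  l = length (family I)
  nodes-graph : nodes (codeGraph (graph I)) ≤ 1 + n * (2 + n * 4)
  nodes-graph = subst (λ m → nodes (codeGraph (graph I)) ≤ 1 + m * (2 + n * 4)) (length-tabulate {n = n} id)
    (nodes-codeList-≤ _ (λ u → nodes-codeSubset (Vec.tabulate (Graph.edge (graph I) u))) (allFin n))
  row≤ : 2 + n * 4 ≤ 6 * P
  row≤ = begin
    2 + n * 4        ≤⟨ +-mono-≤ (*-monoʳ-≤ 2 1≤P) (*-monoˡ-≤ 4 n≤P) ⟩
    2 * P + P * 4    ≡⟨ eq′ P ⟩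
    6 * P            ∎
    where
    eq′ : ∀ P → 2 * P + P * 4 ≡ 6 * P
    eq′ = solve-∀
  eq : ∀ P → suc (1 + P * (6 * P) + (1 + P * (6 * P))) ≡ 3 + 12 * (P * P)
  eq = solve-∀

reduceBy-size : ∀ M I k → 1 ≤ M →
  let I′ , k′ = reduceBy (fits? M I k) I k in
  size I′ + k′ ≤ 16 * (M * M) * (k ⊔ 1) ^ 2
reduceBy-size M I k 1≤M with fits? M I k
... | yes (l≤k , n≤lM) = begin
  size I + k
    ≤⟨ +-mono-≤ (size-bound I 1≤P (≤-trans n≤lM (*-monoˡ-≤ M l≤κ)) (≤-trans l≤κ κ≤P)) k≤PP ⟩
  15 * (P * P) + P * P            ≡⟨ eq κ M ⟩
  16 * (M * M) * (κ * (κ * 1))    ∎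
  where
  open ≤-Reasoning
  κ P : ℕ
  κ = k ⊔ 1
  P = κ * M
  l≤κ : length (family I) ≤ κ
  l≤κ = ≤-trans l≤k (m≤m⊔n k 1)
  κ≤P : κ ≤ P
  κ≤P = m≤m*n κ M {{>-nonZero 1≤M}}
  1≤P : 1 ≤ P
  1≤P = ≤-trans (m≤n⊔m k 1) κ≤P
  k≤PP : k ≤ P * P
  k≤PP = ≤-trans (≤-trans (m≤m⊔n k 1) κ≤P) (m≤m*n P P {{>-nonZero 1≤P}})
  eq : ∀ κ M → 15 * (κ * M * (κ * M)) + κ * M * (κ * M) ≡ 16 * (M * M) * (κ * (κ * 1))
  eq = solve-∀
... | no _ = begin
  -- The code of the empty instance has 3 nodes, and its parameter is 0.
  3                             ≤⟨ m≤m+n 3 13 ⟩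
  16 * (1 * 1) * 1 ^ 2
    ≤⟨ *-mono-≤ (*-monoʳ-≤ 16 (*-mono-≤ 1≤M 1≤M)) (^-monoˡ-≤ 2 (m≤n⊔m k 1)) ⟩
  16 * (M * M) * (k ⊔ 1) ^ 2    ∎
  where open ≤-Reasoning

reduceBy-order : ∀ M I k → order (proj₁ (reduceBy (fits? M I k) I k)) ≤ k * M
reduceBy-order M I k with fits? M I k
... | yes (l≤k , n≤lM) = ≤-trans n≤lM (*-monoˡ-≤ M l≤k)
... | no _             = z≤n

-- The approximation guarantee and the assembled kernel.

liftBy-lossy : ∀ m I k {q c} → 1ℚ ℚ.≤ q → 1ℚ ℚ.≤ fromℕ m ℚ.* (q ℚ.- 1ℚ) → 1ℚ ℚ.≤ c →
  let I′ , k′ = reduceBy (fits? (suc m) I k) I k in ∀ T →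
  Approximate c I′ k′ T → Approximate (q ℚ.* c) I k (liftBy (fits? (suc m) I k) I k T)
liftBy-lossy m I k {q} {c} 1≤q 1≤m[q-1] 1≤c T approx with fits? (suc m) I k
... | yes _    = ≤[]-weaken {v = value I k T} 1≤q 1≤c approx
... | no ¬fits = approximate I k (nonIsolated (graph I)) λ T* l≤k clique-cover cvc* →
  nonIsolated-cvc (graph I) cvc* , (begin
    fromℕ (∣ nonIsolated (graph I) ∣)    ≤⟨ fromℕ-mono-≤ (∣p∣≤n (nonIsolated (graph I))) ⟩
    fromℕ (order I)
      ≤⟨ order≤q*cover {q} (order I) (length (family I)) ∣ T* ∣ m 1≤m[q-1]
                                                 -- `Fits` can fail in two ways; as `l≤k` holds
                                                 -- here, it is the bound on the order that fails.
                                                 (<⇒≤ (≰⇒> λ n≤ → ¬fits (l≤k , n≤)))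
                                                 (order≤cover+cliques (graph I) T* (family I) (proj₁ cvc*)
                                                    (proj₂ (proj₂ (proj₂ clique-cover)))
                                                    (λ v _ → proj₁ (proj₂ (proj₂ clique-cover)) v)) ⟩
    q ℚ.* fromℕ ∣ T* ∣
      ≤⟨ ℚ.*-monoˡ-≤-nonNeg q {{ℚ.nonNegative (ℚ.≤-trans (ℚ.nonNegative⁻¹ 1ℚ) 1≤q)}} (≤*-nonNeg ∣ T* ∣ 1≤c) ⟩
    q ℚ.* (c ℚ.* fromℕ ∣ T* ∣)           ≡⟨ ℚ.*-assoc q c (fromℕ ∣ T* ∣) ⟨
    q ℚ.* c ℚ.* fromℕ ∣ T* ∣             ∎)
  where
  open ℚ.≤-Reasoning

kernel : KernelFamily
kernel α = record
  { reduceProg  = reduceProgram threshold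
  ; liftProg    = liftProgram threshold
  ; reduce      = λ I k → reduceBy (fits? threshold I k) I k
  ; lift        = λ I k → liftBy (fits? threshold I k) I k
  ; reduce-runs = λ I k → let t , _ , run = reduceProgram-runs threshold I k (fits? threshold I k) in t , run
  ; lift-runs   = λ I k T → let t , _ , run = liftProgram-runs threshold I k (fits? threshold I k) T in t , run
  ; lossy       = λ I k T c 1≤c approx q α≤q →
      liftBy-lossy (suc ⌊1/gap⌋) I k (ℚ.<⇒≤ (1<≥α q α≤q)) (threshold-large q α≤q) 1≤c T approx
  }
  where open Threshold α

theorem15 : Σ[ K ∈ KernelFamily ] TimeEfficientPSAKS K ×
    (Σ[ C ∈ ℕ ] ∀ α d → IsCeiling α d →
    ∀ I k → order (output (K α) I k) ≤ C * (k * d))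
theorem15 = kernel , (polynomialSize , timeEfficient) , 2 , few-vertices
  where
  open Threshold

  polynomialSize : PolynomialSize kernel
  polynomialSize = (λ α → 16 * (threshold α * threshold α)) , (λ _ → 2) ,
    λ α I k → reduceBy-size (threshold α) I k (s≤s z≤n)

  reduceTime≤liftTime : ∀ s t → 2 + s ≤ 9 + s + t
  reduceTime≤liftTime s t = ≤-trans (m≤n+m (2 + s) 7) (m≤m+n (9 + s) t)

  timeEfficient : TimeEfficient kernel
  -- For rational `α` the field `bound` is `α` itself, so `den` is its denominator, the second
  -- component of `codeℚ>1`, and `tl` computes it.
  timeEfficient = den , (tl , λ q 1<q → 1 , tl) , 6 , λ α →
      (λ I k → let _ , t≤ , _ = reduceProgram-runs (threshold α) I k (fits? (threshold α) I k) in
        ≤-trans t≤ (≤-trans (reduceTime≤liftTime (fitsTime (threshold α) I k) (66 * nodes (codeGraph (graph I))))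
          (runningTime-instance (threshold α) (den α) I k (s≤s z≤n) (threshold≤4*den α))))
    , (λ I k T → let _ , t≤ , _ = liftProgram-runs (threshold α) I k (fits? (threshold α) I k) T in
        ≤-trans t≤ (runningTime-instance (threshold α) (den α) I k (s≤s z≤n) (threshold≤4*den α)))

  few-vertices : ∀ α d → IsCeiling α d →
    ∀ I k → order (output (kernel α) I k) ≤ 2 * (k * d)
  few-vertices α d ceiling I k = begin
    order (output (kernel α) I k)    ≤⟨ reduceBy-order (threshold α) I k ⟩
    k * threshold α                  ≤⟨ *-monoʳ-≤ k (threshold≤2*ceiling α d ceiling) ⟩
    k * (2 * d)                      ≡⟨ eq k d ⟩
    2 * (k * d)                      ∎
    where
    open ≤-Reasoning
    eq : ∀ k d → k * (2 * d) ≡ 2 * (k * d)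
    eq = solve-∀
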